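{- Let $\delta$ be a positive integer. (i) Every finite oriented graph $D$ with $\delta^+(D)\geq\delta$ contains a directed path of length at least $1.5\delta$. (ii) Every finite digraph $D$ with $\delta^+(D)\geq\delta$ and girth $g\geq 4$ contains a directed path of length at least $1.6535\delta$.
   Context: An oriented graph is a digraph with no 2-cycles, i.e. obtained by orienting the edges of a simple graph. $\delta^+(D)$ is the minimum out-degree. The girth is the minimum length of a directed cycle. The length of a path is its number of arcs. -}

module Defs where

open import Data.Nat using (ℕ; zero; suc; _≤_; _<_)
open import Data.Bool using (Bool; true; false)
open import Data.Fin using (Fin; zero; suc; inject₁; fromℕ)
open import Data.Fin.Subset using (∣_∣)
open import Data.Vec using (tabulate)
open import Relation.Binary.PropositionalEquality using (_≡_)
open import Function.Definitions using (Injective)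

record Digraph : Set where
  field
    n        : ℕ
    arc      : Fin n → Fin n → Bool
    loopless : ∀ v → arc v v ≡ false

open Digraph public

Oriented : Digraph → Set
Oriented D = ∀ u v → arc D u v ≡ true → arc D v u ≡ false

outdeg : (D : Digraph) → Fin (n D) → ℕ
outdeg D v = ∣ tabulate (arc D v) ∣

-- δ⁺(D) ≥ δ  (for a nonempty digraph)
MinOutDeg≥ : Digraph → ℕ → Set
MinOutDeg≥ D δ = ∀ v → δ ≤ outdeg D v

NonEmpty : Digraph → Set
NonEmpty D = 0 < n D

record DirectedPath (D : Digraph) (k : ℕ) : Set where
  field
    vertex   : Fin (suc k) → Fin (n D)
    distinct : Injective _≡_ _≡_ vertex
    arcs     : ∀ (i : Fin k) → arc D (vertex (inject₁ i)) (vertex (suc i)) ≡ true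

-- a directed cycle of length suc m: suc m distinct vertices c₀ → c₁ → … → c_m → c₀
record DirectedCycle (D : Digraph) (m : ℕ) : Set where
  field
    vertex   : Fin (suc m) → Fin (n D)
    distinct : Injective _≡_ _≡_ vertex
    arcs     : ∀ (i : Fin m) → arc D (vertex (inject₁ i)) (vertex (suc i)) ≡ true
    closing  : arc D (vertex (fromℕ m)) (vertex zero) ≡ true

Girth≥ : Digraph → ℕ → Set
Girth≥ D g = ∀ m → DirectedCycle D m → g ≤ suc m

{-# OPTIONS --safe #-}
module Submission where

-- Let P be a longest path whose last vertex closes a cycle C with a final segment of P, chosen
-- with |C| maximal, and let W be the rest of P, with last vertex w.  If W is empty then no arc
-- leaves C, and an oriented graph in which all out-degrees are at least δ has more than 2δ
-- vertices.  If w has an out-neighbour outside P, then W or another cycle joined to C is so long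
-- that there is a path with 2δ arcs, or there is a smaller set of vertices closed under
-- out-neighbours, to which one can pass.  Otherwise let A ⊆ C be the set of cyclic predecessors of the
-- out-neighbours of w.  Entering C at an out-neighbour of w and running around C gives another
-- longest path ending in A, so by maximality all out-neighbours of A lie in C.  As
-- |A| ≥ δ − |W| + 1, a bound c|A| for the minimum out-degree of the digraph induced on A yields a
-- path with at least (2 − c)δ arcs.  In oriented graphs c = 1/2.
--
-- For girth at least 4, c = 0.3465 = 693/2000 is the bound of Hladký, Král' and Norin towards the
-- Caccetta–Häggkvist conjecture.  In a minimal counterexample, several sums over quadruples of
-- vertices are nonnegative: squares; sums expressing that all out-degrees are large; and sums
-- expressing that the common out-neighbourhood of two or three vertices contains a vertex of small
-- out-degree in it, by minimality or by the theorem of Chudnovsky, Seymour and Sullivan that a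
-- triangle-free digraph can be made acyclic by removing at most as many arcs as it has
-- nonadjacent pairs.  A combination of these sums, found by semidefinite programming, is
-- negative on every triangle-free configuration of four vertices.

open import Defs
open import Data.Bool using (Bool; true; false; _∧_; _∨_; not; if_then_else_; T)
open import Data.Empty using (⊥; ⊥-elim)
open import Data.Fin as Fin using (Fin; inject₁)
open import Data.List as List using (List; []; _∷_; _++_; filter; filterᵇ; length; lookup; allFin; initLast; _∷ʳ′_)
open import Data.List.Properties using (++-assoc; length-++; ++-identityʳ; ∷-injective; filter-notAll; length-tabulate)
open import Data.List.Membership.Propositional using (_∈_; _∉_)
open import Data.List.Membership.Propositional.Properties using (∈-∃++; ∈-++⁺ˡ; ∈-++⁺ʳ; ∈-++⁻; ∈-filter⁺; ∈-filter⁻; ∈-lookup; ∈-allFin)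
import Data.List.Membership.DecPropositional as DecMembership
open import Data.List.Relation.Binary.Permutation.Propositional using (_↭_; ↭-refl; ↭-sym; ↭-trans; ↭-reflexive; ↭⇒↭ₛ; prep)
import Data.List.Relation.Binary.Permutation.Propositional as Permutation
open import Data.List.Relation.Binary.Permutation.Propositional.Properties using (shift; ++⁺; ++⁺ˡ; ++⁺ʳ; ++-comm; drop-∷; ∈-resp-↭; ↭-length)
import Data.List.Relation.Binary.Permutation.Setoid.Properties as PermutationProperties
open import Data.List.Relation.Unary.All as All using ([]; _∷_)
import Data.List.Relation.Unary.All.Properties as All
open import Data.List.Relation.Unary.AllPairs using ([]; _∷_)
open import Data.List.Relation.Unary.Any as Any using (here; there)
open import Data.List.Relation.Unary.Linked as Linked using (Linked; []; [-]; _∷_)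
open import Data.List.Relation.Unary.Unique.Propositional using (Unique)
import Data.List.Relation.Unary.Unique.Propositional.Properties as Unique
open import Data.Product using (Σ; ∃; _×_; _,_; proj₁; proj₂)
open import Data.Sum using (_⊎_; inj₁; inj₂)
import Data.Vec as Vec
open import Function using (_∘_; id)
open import Level using (0ℓ)
open import Relation.Binary using (DecidableEquality; Rel)
open import Relation.Binary.PropositionalEquality
open import Relation.Nullary using (¬_; Dec; yes; no)
open import Relation.Nullary.Decidable using (¬?; T?)
open import Relation.Unary using (Decidable)

private variable
  A B : Set

-- Out-degrees in digraphs without short cycles

module Density where

  open import Data.Integer using (ℤ; +_; -[1+_]; 0ℤ; _+_; _*_; _-_; -_; _≤_; _<_; +≤+; -≤+; -<+; _≤?_; ∣_∣; _≤ᵇ_)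
  import Data.Integer.Properties as ℤ
  open import Data.Integer.Tactic.RingSolver using (solve-∀)
  open import Data.Nat as ℕ using (ℕ; zero; suc)
  import Data.Nat.Properties as ℕ

  -- The four-vertex certificate

  data Link : Set where
    none fwd bwd : Link

  flip : Link → Link
  flip none = none
  flip fwd = bwd
  flip bwd = fwd

  isNone isFwd isBwd : Link → Bool
  isNone none = true
  isNone _    = false
  isFwd fwd = true
  isFwd _   = false
  isBwd bwd = true
  isBwd _   = false

  -- A configuration is given by the six links among vertices x, y, z, w; each link is read from the
  -- earlier vertex to the later one.
  Config : Set → Set
  Config A = (xy xz xw yz yw zw : Link) → A

  infixl 6 _⊕_
  _⊕_ : Config ℤ → Config ℤ → Config ℤ
  (F ⊕ G) xy xz xw yz yw zw = F xy xz xw yz yw zw + G xy xz xw yz yw zw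

  -- The weights ψ, σ, φ₁, φ₂, φ₃ and the multipliers in the certificate are a rounded solution of a
  -- semidefinite program.
  ψ : Link → Link → Link → ℕ
  ψ none none none = 9
  ψ none fwd  none = 114
  ψ none bwd  none = 3010
  ψ none bwd  fwd  = 3422
  ψ none bwd  bwd  = 2100
  ψ fwd  fwd  fwd  = 610
  ψ fwd  bwd  none = 2174
  ψ bwd  bwd  none = 44
  ψ bwd  bwd  fwd  = 490
  ψ _    _    _    = 0

  σ : Link → ℕ
  σ none = 1010
  σ fwd  = 4512
  σ bwd  = 0

  φ₁ φ₂ φ₃ : Link → Link → ℤ
  φ₁ none none = + 30
  φ₁ none fwd  = + 32
  φ₁ none bwd  = + 7
  φ₁ fwd  none = + 23
  φ₁ fwd  fwd  = + 13
  φ₁ fwd  bwd  = - + 10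
  φ₁ bwd  none = - + 19
  φ₁ bwd  fwd  = 0ℤ
  φ₁ bwd  bwd  = - + 40
  φ₂ none none = - + 8
  φ₂ none fwd  = + 6
  φ₂ none bwd  = + 40
  φ₂ fwd  none = - + 20
  φ₂ fwd  fwd  = + 2
  φ₂ fwd  bwd  = + 31
  φ₂ bwd  none = - + 38
  φ₂ bwd  fwd  = 0ℤ
  φ₂ bwd  bwd  = + 5
  φ₃ none none = + 11
  φ₃ none fwd  = - + 36
  φ₃ none bwd  = + 33
  φ₃ fwd  none = - + 29
  φ₃ fwd  fwd  = + 30
  φ₃ fwd  bwd  = - + 1
  φ₃ bwd  none = + 39
  φ₃ bwd  fwd  = 0ℤ
  φ₃ bwd  bwd  = - + 40

  ⟦_⟧ : Bool → ℤ
  ⟦ true ⟧  = + 1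
  ⟦ false ⟧ = 0ℤ

  -- Summed over w this is a nonnegative weight times b deg(x) - aN, where N is the number of
  -- vertices, so it is nonnegative when x has out-degree at least (a / b)N.
  degreeTerm : (a b : ℤ) → Config ℤ
  degreeTerm a b xy xz xw yz yw zw = + ψ xy xz yz * (b * ⟦ isFwd xw ⟧ - a)

  -- Here c = b − a.  If A = N⁺(x) ∩ N⁺(y) ∩ N⁺(z) has a vertex of out-degree at most (a / b)|A| in A,
  -- then the sum over w is nonnegative, because the other out-neighbours of that vertex lie outside A
  -- and outside the in-neighbourhoods of x, y and z.
  tripleTerm : (b c : ℤ) → Config ℤ
  tripleTerm b c xy xz xw yz yw zw =
    + σ xy * ⟦ isFwd xz ∧ isFwd yz ⟧
    * (c - b * ⟦ isBwd xw ∨ isBwd yw ∨ isBwd zw ⟧ - c * ⟦ isFwd xw ∧ isFwd yw ∧ isFwd zw ⟧)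

  -- The analogue for A = N⁺(x) ∩ N⁺(y), with a vertex whose out-degree e in A satisfies e² ≤ ν, the
  -- number of ordered nonadjacent pairs in A.
  pairTerm : (m b c d : ℤ) → Config ℤ
  pairTerm m b c d xy xz xw yz yw zw =
    m * ⟦ isFwd xy ⟧
    * (c - b * ⟦ isBwd xw ∨ isBwd yw ⟧ - b * ⟦ isFwd xw ∧ isFwd yw ⟧
       + d * (⟦ isFwd xz ∧ isFwd yz ⟧ * (⟦ isFwd xw ∧ isFwd yw ⟧ * ⟦ isNone zw ⟧)))

  -- For fixed x and y the sum over z and w factors as a multiple of a square.
  squareTerm : (m : ℤ) → (Link → Link → ℤ) → Config ℤ
  squareTerm m φ xy xz xw yz yw zw = m * ⟦ isFwd xy ⟧ * (φ xz yz * φ xw yw)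

  -- With a = 693, b = 2000, k = 40 and r = 25: 1307 = b - a, 1347 = b - a + k, 25000 = kr², and b =
  -- 2kr. The numbers 66, 2274, 345 and 33 are multipliers.
  certificate : Config ℤ
  certificate = degreeTerm (+ 693) (+ 2000) ⊕ tripleTerm (+ 2000) (+ 1307)
    ⊕ pairTerm (+ 66) (+ 2000) (+ 1347) (+ 25000)
    ⊕ squareTerm (+ 2274) φ₁ ⊕ squareTerm (+ 345) φ₂ ⊕ squareTerm (+ 33) φ₃

  -- Applied in turn, these sum a function over the 24 orders of the four vertices.
  sym₂ sym₃ sym₄ : Config ℤ → Config ℤ
  sym₂ F xy xz xw yz yw zw = F xy xz xw yz yw zw + F (flip xy) yz yw xz xw zw
  sym₃ F xy xz xw yz yw zw =
    F xy xz xw yz yw zw + F xz xy xw (flip yz) zw yw + F yz (flip xy) yw (flip xz) zw xw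
  sym₄ F xy xz xw yz yw zw =
    F xy xz xw yz yw zw + F xy xw xz yw yz (flip zw) + F xz xw xy zw (flip yz) (flip yw)
    + F yz yw (flip xy) zw (flip xz) (flip xw)

  cyclic : Link → Link → Link → Bool
  cyclic xy yz xz = (isFwd xy ∧ isFwd yz ∧ isBwd xz) ∨ (isBwd xy ∧ isBwd yz ∧ isFwd xz)

  hasTriangle : Config Bool
  hasTriangle xy xz xw yz yw zw =
    cyclic xy yz xz ∨ cyclic xy yw xw ∨ cyclic xz zw xw ∨ cyclic yz zw yw

  every : (Link → Bool) → Bool
  every p = p none ∧ p fwd ∧ p bwd

  good : Config Bool
  good xy xz xw yz yw zw = hasTriangle xy xz xw yz yw zw ∨ (sym₄ (sym₃ (sym₂ certificate)) xy xz xw yz yw zw ≤ᵇ - + 1)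

  every-sound : ∀ p → every p ≡ true → ∀ l → p l ≡ true
  every-sound p eq l with p none in e₁ | p fwd in e₂ | p bwd in e₃
  every-sound p eq none | true | true | true = e₁
  every-sound p eq fwd  | true | true | true = e₂
  every-sound p eq bwd  | true | true | true = e₃

  -- Six uses of `every-sound` reduce the claim to one Boolean equation, whose `refl` evaluates all
  -- 3⁶ = 729 configurations.
  good-true : ∀ xy xz xw yz yw zw → good xy xz xw yz yw zw ≡ true
  good-true xy xz xw yz yw zw =
    every-sound (λ zw → good xy xz xw yz yw zw)
    (every-sound (λ yw → every λ zw → good xy xz xw yz yw zw)
    (every-sound (λ yz → every λ yw → every λ zw → good xy xz xw yz yw zw)
    (every-sound (λ xw → every λ yz → every λ yw → every λ zw → good xy xz xw yz yw zw)
    (every-sound (λ xz → every λ xw → every λ yz → every λ yw → every λ zw → good xy xz xw yz yw zw)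
    (every-sound (λ xy → every λ xz → every λ xw → every λ yz → every λ yw → every λ zw → good xy xz xw yz yw zw)
     refl xy) xz) xw) yz) yw) zw

  NegativeOnTriangleFree : Config ℤ → Set
  NegativeOnTriangleFree F =
    ∀ xy xz xw yz yw zw → hasTriangle xy xz xw yz yw zw ≡ false → F xy xz xw yz yw zw ≤ - + 1

  symmetrised-negative : NegativeOnTriangleFree (sym₄ (sym₃ (sym₂ certificate)))
  symmetrised-negative xy xz xw yz yw zw no-tri = ℤ.≤ᵇ⇒≤ (subst T (sym claim) _)
    where
    claim : (sym₄ (sym₃ (sym₂ certificate)) xy xz xw yz yw zw ≤ᵇ - + 1) ≡ true
    claim = subst (λ b → b ∨ (sym₄ (sym₃ (sym₂ certificate)) xy xz xw yz yw zw ≤ᵇ - + 1) ≡ true) no-tri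
      (good-true xy xz xw yz yw zw)

  -- Sums over lists

  0≤+ : ∀ {i j} → 0ℤ ≤ i → 0ℤ ≤ j → 0ℤ ≤ i + j
  0≤+ = ℤ.+-mono-≤

  0≤* : ∀ {i j} → 0ℤ ≤ i → 0ℤ ≤ j → 0ℤ ≤ i * j
  0≤* {+ m} {+ n} _ _ = subst (0ℤ ≤_) (ℤ.pos-* m n) (+≤+ ℕ.z≤n)

  0≤square : ∀ i → 0ℤ ≤ i * i
  0≤square (+ n)    = 0≤* {+ n} {+ n} (+≤+ ℕ.z≤n) (+≤+ ℕ.z≤n)
  0≤square -[1+ n ] = +≤+ ℕ.z≤n

  0≤⟦⟧ : ∀ b → 0ℤ ≤ ⟦ b ⟧
  0≤⟦⟧ true  = +≤+ ℕ.z≤n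
  0≤⟦⟧ false = +≤+ ℕ.z≤n

  ⟦⟧≤1 : ∀ b → ⟦ b ⟧ ≤ + 1
  ⟦⟧≤1 true  = ℤ.≤-refl
  ⟦⟧≤1 false = +≤+ ℕ.z≤n

  ∑ : List A → (A → ℤ) → ℤ
  ∑ []       f = 0ℤ
  ∑ (x ∷ xs) f = f x + ∑ xs f

  # : List A → ℤ
  # L = ∑ L (λ _ → + 1)

  ∑-cong : ∀ (L : List A) {f g} → (∀ x → f x ≡ g x) → ∑ L f ≡ ∑ L g
  ∑-cong []      eq = refl
  ∑-cong (x ∷ L) eq = cong₂ _+_ (eq x) (∑-cong L eq)

  ∑-mono : ∀ (L : List A) {f g} → (∀ {x} → x ∈ L → f x ≤ g x) → ∑ L f ≤ ∑ L g
  ∑-mono []      le = ℤ.≤-refl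
  ∑-mono (x ∷ L) le = ℤ.+-mono-≤ (le (here refl)) (∑-mono L (le ∘ there))

  ∑-nonneg : ∀ (L : List A) {f} → (∀ {x} → x ∈ L → 0ℤ ≤ f x) → 0ℤ ≤ ∑ L f
  ∑-nonneg []      nn = ℤ.≤-refl
  ∑-nonneg (x ∷ L) nn = 0≤+ (nn (here refl)) (∑-nonneg L (nn ∘ there))

  ∑-distrib-+ : ∀ (L : List A) f g → ∑ L (λ x → f x + g x) ≡ ∑ L f + ∑ L g
  ∑-distrib-+ []      f g = refl
  ∑-distrib-+ (x ∷ L) f g =
    trans (cong (λ s → f x + g x + s) (∑-distrib-+ L f g)) (interchange (f x) (g x) (∑ L f) (∑ L g))
    where
    interchange : ∀ a b c d → a + b + (c + d) ≡ a + c + (b + d)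
    interchange = solve-∀

  ∑-*ˡ : ∀ (L : List A) k f → ∑ L (λ x → k * f x) ≡ k * ∑ L f
  ∑-*ˡ []      k f = sym (ℤ.*-zeroʳ k)
  ∑-*ˡ (x ∷ L) k f = trans (cong (λ s → k * f x + s) (∑-*ˡ L k f)) (sym (ℤ.*-distribˡ-+ k (f x) (∑ L f)))

  ∑-*ʳ : ∀ (L : List A) k f → ∑ L (λ x → f x * k) ≡ ∑ L f * k
  ∑-*ʳ L k f = trans (∑-cong L (λ x → ℤ.*-comm (f x) k)) (trans (∑-*ˡ L k f) (ℤ.*-comm k (∑ L f)))

  ∑-const : ∀ (L : List A) k → ∑ L (λ _ → k) ≡ k * # L
  ∑-const L k = trans (∑-cong L (λ _ → sym (ℤ.*-identityʳ k))) (∑-*ˡ L k (λ _ → + 1))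

  ∑-swap : ∀ (L : List A) (M : List B) (f : A → B → ℤ) →
           ∑ L (λ x → ∑ M (f x)) ≡ ∑ M (λ y → ∑ L (λ x → f x y))
  ∑-swap []      M f = sym (∑-const M 0ℤ)
  ∑-swap (x ∷ L) M f =
    trans (cong (λ s → ∑ M (f x) + s) (∑-swap L M f)) (sym (∑-distrib-+ M (f x) (λ y → ∑ L (λ x → f x y))))

  ∑-++ : ∀ (L M : List A) f → ∑ (L ++ M) f ≡ ∑ L f + ∑ M f
  ∑-++ []      M f = sym (ℤ.+-identityˡ (∑ M f))
  ∑-++ (x ∷ L) M f = trans (cong (λ s → f x + s) (∑-++ L M f)) (sym (ℤ.+-assoc (f x) (∑ L f) (∑ M f)))

  ∑-↭ : ∀ {L M : List A} → L ↭ M → ∀ f → ∑ L f ≡ ∑ M f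
  ∑-↭ Permutation.refl f = refl
  ∑-↭ (prep x p) f = cong (λ s → f x + s) (∑-↭ p f)
  ∑-↭ (Permutation.swap {ys = ys} x y p) f =
    trans (cong (λ s → f x + (f y + s)) (∑-↭ p f)) (lemma (f x) (f y) (∑ ys f))
    where
    lemma : ∀ a b c → a + (b + c) ≡ b + (a + c)
    lemma = solve-∀
  ∑-↭ (Permutation.trans p q) f = trans (∑-↭ p f) (∑-↭ q f)

  ∑-filter : ∀ (p : A → Bool) L f → ∑ (filterᵇ p L) f ≡ ∑ L (λ x → ⟦ p x ⟧ * f x)
  ∑-filter p []      f = refl
  ∑-filter p (x ∷ L) f with p x
  ... | true  = cong₂ _+_ (sym (ℤ.*-identityˡ (f x))) (∑-filter p L f)
  ... | false = trans (∑-filter p L f) (sym (ℤ.+-identityˡ _))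

  #-filter : ∀ (p : A → Bool) L → # (filterᵇ p L) ≡ ∑ L (λ x → ⟦ p x ⟧)
  #-filter p L = trans (∑-filter p L _) (∑-cong L (λ x → ℤ.*-identityʳ ⟦ p x ⟧))

  ∑-pairs-* : ∀ (L M : List A) f g → ∑ L (λ x → ∑ M (λ y → f x * g y)) ≡ ∑ L f * ∑ M g
  ∑-pairs-* L M f g = trans (∑-cong L (λ x → ∑-*ˡ M (f x) g)) (∑-*ʳ L (∑ M g) f)

  -- Averaging: if f exceeded g at every entry of a nonempty list, its sum would be larger too.
  ∑-≤-∃ : ∀ (x : A) L f g → ∑ (x ∷ L) f ≤ ∑ (x ∷ L) g → ∃ λ y → y ∈ x ∷ L × f y ≤ g y
  ∑-≤-∃ x L f g le with f x ≤? g x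
  ... | yes fx≤gx = x , here refl , fx≤gx
  ∑-≤-∃ x [] f g le | no fx≰gx =
    ⊥-elim (fx≰gx (subst₂ _≤_ (ℤ.+-identityʳ (f x)) (ℤ.+-identityʳ (g x)) le))
  ∑-≤-∃ x (y ∷ L) f g le | no fx≰gx with ∑ (y ∷ L) f ≤? ∑ (y ∷ L) g
  ... | yes le′ = let z , z∈ , fz≤gz = ∑-≤-∃ y L f g le′ in z , there z∈ , fz≤gz
  ... | no  gt  = ⊥-elim (ℤ.<-irrefl refl (ℤ.<-≤-trans (ℤ.+-mono-< (ℤ.≰⇒> fx≰gx) (ℤ.≰⇒> gt)) le))

  argmin : ∀ (x : A) L (f : A → ℤ) → ∃ λ y → y ∈ x ∷ L × (∀ {z} → z ∈ x ∷ L → f y ≤ f z)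
  argmin x []      f = x , here refl , λ { (here refl) → ℤ.≤-refl }
  argmin x (y ∷ L) f with argmin y L f
  ... | m , m∈ , min with f x ≤? f m
  ...   | yes fx≤fm = x , here refl , λ { (here refl) → ℤ.≤-refl ; (there z∈) → ℤ.≤-trans fx≤fm (min z∈) }
  ...   | no  fx≰fm = m , there m∈ , λ { (here refl) → ℤ.<⇒≤ (ℤ.≰⇒> fx≰fm) ; (there z∈) → min z∈ }

  ∈-filterᵇ⁻ : ∀ (p : A → Bool) {x} L → x ∈ filterᵇ p L → x ∈ L × p x ≡ true
  ∈-filterᵇ⁻ p (y ∷ L) x∈ with p y in eq
  ∈-filterᵇ⁻ p (y ∷ L) (here refl) | true = here refl , eq
  ∈-filterᵇ⁻ p (y ∷ L) (there x∈) | true = let x∈L , px = ∈-filterᵇ⁻ p L x∈ in there x∈L , px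
  ∈-filterᵇ⁻ p (y ∷ L) x∈ | false = let x∈L , px = ∈-filterᵇ⁻ p L x∈ in there x∈L , px

  ∈-filterᵇ⁺ : ∀ (p : A → Bool) {x} L → x ∈ L → p x ≡ true → x ∈ filterᵇ p L
  ∈-filterᵇ⁺ p (y ∷ L) (here refl) px rewrite px = here refl
  ∈-filterᵇ⁺ p (y ∷ L) (there x∈) px with p y
  ... | true  = there (∈-filterᵇ⁺ p L x∈ px)
  ... | false = ∈-filterᵇ⁺ p L x∈ px

  -- Nonadjacent pairs in triangle-free digraphs

  +-cancelˡ-≤ : ∀ k i j → k + i ≤ k + j → i ≤ j
  +-cancelˡ-≤ k i j le = ℤ.0≤i-j⇒j≤i (subst (0ℤ ≤_) (lemma k i j) (ℤ.i≤j⇒0≤j-i le))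
    where
    lemma : ∀ k i j → k + j - (k + i) ≡ j - i
    lemma = solve-∀

  length-filterᵇ-< : ∀ (p : A → Bool) {u} L → u ∈ L → p u ≡ false → length (filterᵇ p L) ℕ.< length L
  length-filterᵇ-≤ : ∀ (p : A → Bool) L → length (filterᵇ p L) ℕ.≤ length L
  length-filterᵇ-≤ p []      = ℕ.z≤n
  length-filterᵇ-≤ p (x ∷ L) with p x
  ... | true  = ℕ.s≤s (length-filterᵇ-≤ p L)
  ... | false = ℕ.m≤n⇒m≤1+n (length-filterᵇ-≤ p L)
  length-filterᵇ-< p (x ∷ L) (here refl) pu rewrite pu = ℕ.s≤s (length-filterᵇ-≤ p L)
  length-filterᵇ-< p (x ∷ L) (there u∈) pu with p x
  ... | true  = ℕ.s≤s (length-filterᵇ-< p L u∈ pu)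
  ... | false = ℕ.m≤n⇒m≤1+n (length-filterᵇ-< p L u∈ pu)

  filterᵇ-split : ∀ (p : A → Bool) L → filterᵇ p L ++ filterᵇ (not ∘ p) L ↭ L
  filterᵇ-split p []      = ↭-refl
  filterᵇ-split p (x ∷ L) with p x
  ... | true  = prep x (filterᵇ-split p L)
  ... | false = ↭-trans (shift x (filterᵇ p L) _) (prep x (filterᵇ-split p L))

  ∑∑-filter : ∀ (p q : A → Bool) L (h : A → A → ℤ) →
    ∑ (filterᵇ p L) (λ x → ∑ (filterᵇ q L) (h x)) ≡ ∑ L (λ x → ∑ L (λ y → ⟦ p x ⟧ * (⟦ q y ⟧ * h x y)))
  ∑∑-filter p q L h = trans (∑-filter p L _) (∑-cong L λ x →
    trans (cong (λ s → ⟦ p x ⟧ * s) (∑-filter q L (h x))) (sym (∑-*ˡ L ⟦ p x ⟧ _)))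

  #≡length : ∀ (L : List A) → # L ≡ + length L
  #≡length []      = refl
  #≡length (x ∷ L) = cong (λ s → + 1 + s) (#≡length L)

  -- Average out-degree without 2-cycles

  module OutDegree {V : Set} (_⇒_ : V → V → Bool) where

    deg : List V → V → ℤ
    deg L v = ∑ L (λ w → ⟦ v ⇒ w ⟧)

    deg≡length : ∀ L v → deg L v ≡ + length (filterᵇ (v ⇒_) L)
    deg≡length L v = trans (sym (#-filter (v ⇒_) L)) (#≡length (filterᵇ (v ⇒_) L))

    module _ (no-digon : ∀ {u v} → u ⇒ v ≡ true → v ⇒ u ≡ true → ⊥) where

      ⟦⇒⟧+⟦⇐⟧≤1 : ∀ u v → ⟦ u ⇒ v ⟧ + ⟦ v ⇒ u ⟧ ≤ + 1
      ⟦⇒⟧+⟦⇐⟧≤1 u v with u ⇒ v in uv | v ⇒ u in vu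
      ... | true  | true  = ⊥-elim (no-digon uv vu)
      ... | true  | false = ℤ.≤-refl
      ... | false | true  = ℤ.≤-refl
      ... | false | false = +≤+ ℕ.z≤n

      -- Without loops and 2-cycles, each of the m(m - 1)/2 pairs of positions carries at most one
      -- arc. The induction adds the pairs that contain the first entry.
      ∑-deg≤ : ∀ L → + 2 * ∑ L (deg L) + # L ≤ # L * # L
      ∑-deg≤ []      = ℤ.≤-refl
      ∑-deg≤ (x ∷ L) = begin
        + 2 * ∑ (x ∷ L) (deg (x ∷ L)) + (+ 1 + m)
          ≡⟨ cong (λ s → + 2 * s + (+ 1 + m)) expand ⟩
        + 2 * (⟦ x ⇒ x ⟧ + (deg L x + ∑ L (λ v → ⟦ v ⇒ x ⟧)) + a) + (+ 1 + m)
          ≡⟨ cong (λ b → + 2 * (⟦ b ⟧ + (deg L x + ∑ L (λ v → ⟦ v ⇒ x ⟧)) + a) + (+ 1 + m)) loop ⟩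
        + 2 * (0ℤ + (deg L x + ∑ L (λ v → ⟦ v ⇒ x ⟧)) + a) + (+ 1 + m)
          ≤⟨ ℤ.+-monoˡ-≤ (+ 1 + m) (ℤ.*-monoˡ-≤-nonNeg (+ 2) (ℤ.+-monoˡ-≤ a (ℤ.+-monoʳ-≤ 0ℤ neighbours))) ⟩
        + 2 * (0ℤ + m + a) + (+ 1 + m)    ≡⟨ rearrange m a ⟩
        (+ 2 * a + m) + (+ 2 * m + + 1)   ≤⟨ ℤ.+-monoˡ-≤ (+ 2 * m + + 1) (∑-deg≤ L) ⟩
        m * m + (+ 2 * m + + 1)           ≡⟨ square m ⟩
        (+ 1 + m) * (+ 1 + m)             ∎
        where
        open ℤ.≤-Reasoning
        m a : ℤ
        m = # L
        a = ∑ L (deg L)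
        loop : x ⇒ x ≡ false
        loop with x ⇒ x in xx
        ... | true  = ⊥-elim (no-digon xx xx)
        ... | false = refl
        assoc : ∀ a b c d → a + b + (c + d) ≡ a + (b + c) + d
        assoc = solve-∀
        expand : ∑ (x ∷ L) (deg (x ∷ L)) ≡ ⟦ x ⇒ x ⟧ + (deg L x + ∑ L (λ v → ⟦ v ⇒ x ⟧)) + a
        expand = trans (cong (λ s → deg (x ∷ L) x + s) (∑-distrib-+ L (λ v → ⟦ v ⇒ x ⟧) (deg L)))
          (assoc ⟦ x ⇒ x ⟧ (deg L x) (∑ L (λ v → ⟦ v ⇒ x ⟧)) a)
        neighbours : deg L x + ∑ L (λ v → ⟦ v ⇒ x ⟧) ≤ m
        neighbours = subst (_≤ m) (∑-distrib-+ L (λ v → ⟦ x ⇒ v ⟧) (λ v → ⟦ v ⇒ x ⟧))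
          (∑-mono L (λ {v} _ → ⟦⇒⟧+⟦⇐⟧≤1 x v))
        rearrange : ∀ m a → + 2 * (0ℤ + m + a) + (+ 1 + m) ≡ (+ 2 * a + m) + (+ 2 * m + + 1)
        rearrange = solve-∀
        square : ∀ m → m * m + (+ 2 * m + + 1) ≡ (+ 1 + m) * (+ 1 + m)
        square = solve-∀

      ∃-half : ∀ x L → ∃ λ z → z ∈ x ∷ L × 2 ℕ.* length (filterᵇ (z ⇒_) (x ∷ L)) ℕ.< length (x ∷ L)
      ∃-half x L = convert (∑-≤-∃ x L (λ z → + 2 * deg M z + + 1) (λ _ → # M) average)
        where
        M = x ∷ L
        average : ∑ M (λ z → + 2 * deg M z + + 1) ≤ ∑ M (λ _ → # M)
        average = subst₂ _≤_
          (sym (trans (∑-distrib-+ M (λ z → + 2 * deg M z) (λ _ → + 1)) (cong (λ s → s + # M) (∑-*ˡ M (+ 2) (deg M)))))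
          (sym (∑-const M (# M))) (∑-deg≤ M)
        convert : (∃ λ z → z ∈ M × + 2 * deg M z + + 1 ≤ # M) → ∃ λ z → z ∈ M × 2 ℕ.* length (filterᵇ (z ⇒_) M) ℕ.< length M
        convert (z , z∈ , le) =
          z , z∈ , subst (ℕ._≤ length M) (ℕ.+-comm _ 1) (ℤ.drop‿+≤+ (subst₂ _≤_ lhs (#≡length M) le))
          where
          d = length (filterᵇ (z ⇒_) M)
          lhs : + 2 * deg M z + + 1 ≡ + (2 ℕ.* d ℕ.+ 1)
          lhs = cong (λ s → s + + 1) (trans (cong (λ s → + 2 * s) (deg≡length M z)) (sym (ℤ.pos-* 2 d)))

  module TriangleFree {V : Set} (_⇒_ : V → V → Bool)
    (no-digon : ∀ {u v} → u ⇒ v ≡ true → v ⇒ u ≡ true → ⊥)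
    (no-triangle : ∀ {u v w} → u ⇒ v ≡ true → v ⇒ w ≡ true → w ⇒ u ≡ true → ⊥) where

    open OutDegree _⇒_ public

    deg-↭ : ∀ {L M} → L ↭ M → ∀ v → deg L v ≡ deg M v
    deg-↭ p v = ∑-↭ p (λ w → ⟦ v ⇒ w ⟧)

    link : V → V → Link
    link u v = if u ⇒ v then fwd else if v ⇒ u then bwd else none

    isFwd-link : ∀ u v → isFwd (link u v) ≡ u ⇒ v
    isFwd-link u v with u ⇒ v | v ⇒ u
    ... | true  | _     = refl
    ... | false | true  = refl
    ... | false | false = refl

    isBwd-link : ∀ u v → isBwd (link u v) ≡ v ⇒ u
    isBwd-link u v with u ⇒ v in uv | v ⇒ u in vu
    ... | true  | true  = ⊥-elim (no-digon uv vu)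
    ... | true  | false = refl
    ... | false | true  = refl
    ... | false | false = refl

    link-flip : ∀ u v → link v u ≡ flip (link u v)
    link-flip u v with u ⇒ v in uv | v ⇒ u in vu
    ... | true  | true  = ⊥-elim (no-digon uv vu)
    ... | true  | false = refl
    ... | false | true  = refl
    ... | false | false = refl

    no-loop : ∀ v → v ⇒ v ≡ false
    no-loop v with v ⇒ v in vv
    ... | true  = ⊥-elim (no-digon vv vv)
    ... | false = refl

    infix 5 _∥_
    _∥_ : V → V → Bool
    u ∥ v = isNone (link u v)

    ∥-sym : ∀ u v → u ∥ v ≡ v ∥ u
    ∥-sym u v rewrite link-flip u v with link u v
    ... | none = refl
    ... | fwd  = refl
    ... | bwd  = refl

    -- For `L` = `M` ordered pairs are counted, hence each unordered pair twice. A vertex counts as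
    -- nonadjacent to itself, so the diagonal is included.
    nonadjacent : List V → List V → ℤ
    nonadjacent L M = ∑ L (λ x → ∑ M (λ y → ⟦ x ∥ y ⟧))

    nonadjacent-sym : ∀ L M → nonadjacent L M ≡ nonadjacent M L
    nonadjacent-sym L M = trans (∑-swap L M _) (∑-cong M (λ y → ∑-cong L (λ x → cong ⟦_⟧ (∥-sym x y))))

    nonadjacent-nonneg : ∀ L M → 0ℤ ≤ nonadjacent L M
    nonadjacent-nonneg L M = ∑-nonneg L (λ {x} _ → ∑-nonneg M (λ {y} _ → 0≤⟦⟧ (x ∥ y)))

    nonadjacent-↭ : ∀ {L M} → L ↭ M → nonadjacent L L ≡ nonadjacent M M
    nonadjacent-↭ {L} {M} p = trans (∑-↭ p _) (∑-cong M (λ x → ∑-↭ p _))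

    nonadjacent-++ : ∀ L M → nonadjacent (L ++ M) (L ++ M)
      ≡ nonadjacent L L + nonadjacent M M + + 2 * nonadjacent L M
    nonadjacent-++ L M = trans (∑-++ L M _) (trans
      (cong₂ _+_ (trans (∑-cong L (λ x → ∑-++ L M _)) (∑-distrib-+ L _ _))
                 (trans (∑-cong M (λ x → ∑-++ L M _)) (∑-distrib-+ M _ _)))
      (trans (cong (λ s → nonadjacent L L + nonadjacent L M + (s + nonadjacent M M)) (nonadjacent-sym M L))
             (lemma (nonadjacent L L) (nonadjacent L M) (nonadjacent M M))))
      where
      lemma : ∀ a b c → a + b + (b + c) ≡ a + c + + 2 * b
      lemma = solve-∀

    -- The arcs that point forwards in the order of the list. Removing them leaves an acyclic
    -- digraph, so this bounds the size of a feedback arc set.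
    forward : List V → ℤ
    forward []      = 0ℤ
    forward (x ∷ L) = deg L x + forward L

    deg-nonneg : ∀ L v → 0ℤ ≤ deg L v
    deg-nonneg L v = ∑-nonneg L (λ {w} _ → 0≤⟦⟧ (v ⇒ w))

    forward-nonneg : ∀ L → 0ℤ ≤ forward L
    forward-nonneg []      = ℤ.≤-refl
    forward-nonneg (x ∷ L) = 0≤+ (deg-nonneg L x) (forward-nonneg L)

    forward-++ : ∀ L M → forward (L ++ M) ≡ forward L + forward M + ∑ L (deg M)
    forward-++ []      M = lemma (forward M)
      where
      lemma : ∀ a → a ≡ 0ℤ + a + 0ℤ
      lemma = solve-∀
    forward-++ (x ∷ L) M = trans (cong₂ _+_ (∑-++ L M _) (forward-++ L M))
      (lemma (deg L x) (deg M x) (forward L) (forward M) (∑ L (deg M)))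
      where
      lemma : ∀ a b c d e → a + b + (c + d + e) ≡ a + c + d + (b + e)
      lemma = solve-∀

    -- Both count two-arc paths with nonadjacent ends: the first those that start at `v`, the second
    -- those with `v` in the middle.
    pathsFrom pathsThrough : List V → V → ℤ
    pathsFrom L v = ∑ L (λ x → ∑ L (λ y → ⟦ v ⇒ x ⟧ * (⟦ x ⇒ y ⟧ * ⟦ v ∥ y ⟧)))
    pathsThrough L v = ∑ L (λ x → ∑ L (λ y → ⟦ y ⇒ v ⟧ * (⟦ v ⇒ x ⟧ * ⟦ y ∥ x ⟧)))

    ∑-pathsFrom≡∑-pathsThrough : ∀ L → ∑ L (pathsFrom L) ≡ ∑ L (pathsThrough L)
    ∑-pathsFrom≡∑-pathsThrough L = trans (∑-swap L L _) (∑-cong L (λ x → ∑-swap L L _))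

    ∃-paths≤ : ∀ u L → ∃ λ v → v ∈ u ∷ L × pathsFrom (u ∷ L) v ≤ pathsThrough (u ∷ L) v
    ∃-paths≤ u L = ∑-≤-∃ u L _ _ (ℤ.≤-reflexive (∑-pathsFrom≡∑-pathsThrough (u ∷ L)))

    module _ (L : List V) (v : V) where
      private
        out in′ : List V
        out = filterᵇ (v ⇒_) L
        in′ = filterᵇ (not ∘ (v ⇒_)) L

      -- For an arc x → y of the cut, v → x holds and v → y fails. An arc y → v would close a
      -- triangle, so v and y are nonadjacent.
      cut-arcs≤ : ∑ out (deg in′) ≤ pathsFrom L v
      cut-arcs≤ = subst (_≤ pathsFrom L v) (sym (∑∑-filter _ _ L _))
        (∑-mono L (λ {x} _ → ∑-mono L (λ {y} _ → pointwise x y)))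
        where
        pointwise : ∀ x y → ⟦ v ⇒ x ⟧ * (⟦ not (v ⇒ y) ⟧ * ⟦ x ⇒ y ⟧) ≤ ⟦ v ⇒ x ⟧ * (⟦ x ⇒ y ⟧ * ⟦ v ∥ y ⟧)
        pointwise x y with v ⇒ x in vx | x ⇒ y in xy | v ⇒ y | y ⇒ v in yv
        ... | false | _     | _     | _     = ℤ.≤-refl
        ... | true  | false | true  | _     = ℤ.≤-refl
        ... | true  | false | false | _     = ℤ.≤-refl
        ... | true  | true  | true  | _     = ℤ.≤-refl
        ... | true  | true  | false | true  = ⊥-elim (no-triangle vx xy yv)
        ... | true  | true  | false | false = ℤ.≤-refl

      -- In an induced path y → v → x, the end x is an out-neighbour of v, and y is not one because
      -- there are no 2-cycles.
      ≤cut-nonadjacent : pathsThrough L v ≤ nonadjacent out in′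
      ≤cut-nonadjacent = subst (pathsThrough L v ≤_) (sym (∑∑-filter _ _ L _))
        (∑-mono L (λ {x} _ → ∑-mono L (λ {y} _ → pointwise x y)))
        where
        pointwise : ∀ x y → ⟦ y ⇒ v ⟧ * (⟦ v ⇒ x ⟧ * ⟦ y ∥ x ⟧) ≤ ⟦ v ⇒ x ⟧ * (⟦ not (v ⇒ y) ⟧ * ⟦ x ∥ y ⟧)
        pointwise x y rewrite ∥-sym x y with y ⇒ v in yv | v ⇒ x | v ⇒ y in vy | y ∥ x
        ... | true  | _     | true  | _     = ⊥-elim (no-digon yv vy)
        ... | true  | true  | false | true  = ℤ.≤-refl
        ... | true  | true  | false | false = ℤ.≤-refl
        ... | true  | false | false | _     = ℤ.≤-refl
        ... | false | true  | true  | _     = ℤ.≤-refl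
        ... | false | true  | false | true  = +≤+ ℕ.z≤n
        ... | false | true  | false | false = ℤ.≤-refl
        ... | false | false | _     | _     = ℤ.≤-refl

    -- Chudnovsky, Seymour and Sullivan.  Induced paths v → x → y can be counted from their first or
    -- from their middle vertex, so some v starts at most as many of them as it is the middle of.  Cut
    -- the list into the out-neighbours of v and the rest: the arcs from the former to the latter
    -- start in induced paths from v, and the induced paths through v give nonadjacent pairs across.
    feedback≤nonadjacent : ∀ n L → length L ℕ.≤ n → ∃ λ M → M ↭ L × + 2 * forward M ≤ nonadjacent L L
    feedback≤nonadjacent n [] _ = [] , ↭-refl , ℤ.≤-refl
    feedback≤nonadjacent (suc n) L@(u ∷ L′) (ℕ.s≤s len) with ∃-paths≤ u L′
    ... | v , v∈L , f≤g with filterᵇ (v ⇒_) L in eq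
    -- A vertex with no out-neighbour in the list can be put first without creating a forward arc.
    ...   | [] = v ∷ M , ↭-trans (prep v M↭) v∷R↭L , bound
      where
      split = ∈-∃++ v∈L
      R = proj₁ split ++ proj₁ (proj₂ split)
      v∷R↭L : v ∷ R ↭ L
      v∷R↭L = subst (v ∷ R ↭_) (sym (proj₂ (proj₂ split))) (↭-sym (shift v (proj₁ split) _))
      rec = feedback≤nonadjacent n R (ℕ.s≤s⁻¹ (ℕ.≤-trans (ℕ.≤-reflexive (↭-length v∷R↭L)) (ℕ.s≤s len)))
      M = proj₁ rec
      M↭ = proj₁ (proj₂ rec)
      deg-M : deg M v ≡ 0ℤ
      deg-M = begin
        deg M v              ≡⟨ deg-↭ M↭ v ⟩
        deg R v              ≡⟨ ℤ.+-identityˡ _ ⟨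
        0ℤ + deg R v         ≡⟨ cong (λ b → ⟦ b ⟧ + deg R v) (no-loop v) ⟨
        deg (v ∷ R) v        ≡⟨ deg-↭ v∷R↭L v ⟩
        deg L v              ≡⟨ #-filter (v ⇒_) L ⟨
        # (filterᵇ (v ⇒_) L) ≡⟨ cong # eq ⟩
        0ℤ                   ∎
        where open ≡-Reasoning
      bound : + 2 * (deg M v + forward M) ≤ nonadjacent L L
      bound = begin
        + 2 * (deg M v + forward M)                       ≡⟨ cong (λ s → + 2 * (s + forward M)) deg-M ⟩
        + 2 * (0ℤ + forward M)                            ≡⟨ cong (λ s → + 2 * s) (ℤ.+-identityˡ (forward M)) ⟩
        + 2 * forward M                                   ≤⟨ proj₂ (proj₂ rec) ⟩
        nonadjacent R R                                   ≡⟨ ℤ.+-identityˡ _ ⟨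
        0ℤ + nonadjacent R R                              ≤⟨ ℤ.+-mono-≤ (nonadjacent-nonneg (v ∷ []) (v ∷ [])) ℤ.≤-refl ⟩
        nonadjacent (v ∷ []) (v ∷ []) + nonadjacent R R   ≡⟨ ℤ.+-identityʳ _ ⟨
        nonadjacent (v ∷ []) (v ∷ []) + nonadjacent R R + 0ℤ
          ≤⟨ ℤ.+-monoʳ-≤ (nonadjacent (v ∷ []) (v ∷ []) + nonadjacent R R) (0≤* {+ 2} (+≤+ ℕ.z≤n) (nonadjacent-nonneg (v ∷ []) R)) ⟩
        nonadjacent (v ∷ []) (v ∷ []) + nonadjacent R R + + 2 * nonadjacent (v ∷ []) R
                                                          ≡⟨ nonadjacent-++ (v ∷ []) R ⟨
        nonadjacent (v ∷ R) (v ∷ R)                       ≡⟨ nonadjacent-↭ v∷R↭L ⟩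
        nonadjacent L L                                   ∎
        where open ℤ.≤-Reasoning
    -- The out-neighbours of `v` are put first, so that the forward arcs between the two parts are
    -- exactly the arcs of the cut. Both parts are shorter than `L`: the first lacks `v`, the second
    -- lacks `w`.
    ...   | w ∷ O′ = proj₁ rec₁ ++ proj₁ rec₂
                   , ↭-trans (++⁺ M₁↭ M₂↭) split
                   , bound
      where
      O I : List V
      O = w ∷ O′
      I = filterᵇ (not ∘ (v ⇒_)) L
      split : O ++ I ↭ L
      split = subst (λ X → X ++ I ↭ L) eq (filterᵇ-split (v ⇒_) L)
      rec₁ = feedback≤nonadjacent n O
        (ℕ.s≤s⁻¹ (ℕ.≤-trans (subst (λ X → length X ℕ.< length L) eq (length-filterᵇ-< (v ⇒_) L v∈L (no-loop v))) (ℕ.s≤s len)))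
      w-out : v ⇒ w ≡ true
      w-out = proj₂ (∈-filterᵇ⁻ (v ⇒_) L (subst (w ∈_) (sym eq) (here refl)))
      w∈L : w ∈ L
      w∈L = proj₁ (∈-filterᵇ⁻ (v ⇒_) L (subst (w ∈_) (sym eq) (here refl)))
      rec₂ = feedback≤nonadjacent n I
        (ℕ.s≤s⁻¹ (ℕ.≤-trans (length-filterᵇ-< (not ∘ (v ⇒_)) L w∈L (cong not w-out)) (ℕ.s≤s len)))
      M₁↭ = proj₁ (proj₂ rec₁)
      M₂↭ = proj₁ (proj₂ rec₂)
      M₁ = proj₁ rec₁
      M₂ = proj₁ rec₂
      cross : ∑ M₁ (deg M₂) ≤ nonadjacent O I
      cross = begin
        ∑ M₁ (deg M₂)        ≡⟨ ∑-↭ M₁↭ _ ⟩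
        ∑ O (deg M₂)         ≡⟨ ∑-cong O (deg-↭ M₂↭) ⟩
        ∑ O (deg I)          ≡⟨ cong (λ X → ∑ X (deg I)) eq ⟨
        ∑ (filterᵇ (v ⇒_) L) (deg I) ≤⟨ cut-arcs≤ L v ⟩
        pathsFrom L v  ≤⟨ f≤g ⟩
        pathsThrough L v     ≤⟨ ≤cut-nonadjacent L v ⟩
        nonadjacent (filterᵇ (v ⇒_) L) I ≡⟨ cong (λ X → nonadjacent X I) eq ⟩
        nonadjacent O I      ∎
        where open ℤ.≤-Reasoning
      distrib : ∀ a b c → + 2 * (a + b + c) ≡ + 2 * a + + 2 * b + + 2 * c
      distrib = solve-∀
      bound : + 2 * forward (M₁ ++ M₂) ≤ nonadjacent L L
      bound = begin
        + 2 * forward (M₁ ++ M₂)                             ≡⟨ cong (λ s → + 2 * s) (forward-++ M₁ M₂) ⟩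
        + 2 * (forward M₁ + forward M₂ + ∑ M₁ (deg M₂))      ≡⟨ distrib (forward M₁) (forward M₂) _ ⟩
        + 2 * forward M₁ + + 2 * forward M₂ + + 2 * ∑ M₁ (deg M₂)
          ≤⟨ ℤ.+-mono-≤ (ℤ.+-mono-≤ (proj₂ (proj₂ rec₁)) (proj₂ (proj₂ rec₂))) (ℤ.*-monoˡ-≤-nonNeg (+ 2) cross) ⟩
        nonadjacent O O + nonadjacent I I + + 2 * nonadjacent O I ≡⟨ nonadjacent-++ O I ⟨
        nonadjacent (O ++ I) (O ++ I)                        ≡⟨ nonadjacent-↭ split ⟩
        nonadjacent L L                                      ∎
        where open ℤ.≤-Reasoning

    -- Deleting the first vertex lowers every out-degree by at most one, so successive first
    -- vertices contribute at least j, j - 1, ..., 1 forward arcs.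
    forward-triangular : ∀ j x L → (∀ {y} → y ∈ x ∷ L → + j ≤ deg (x ∷ L) y) →
      + j * (+ 1 + + j) ≤ + 2 * forward (x ∷ L)
    forward-triangular zero x L _ = 0≤* {+ 2} (+≤+ ℕ.z≤n) (forward-nonneg (x ∷ L))
    forward-triangular (suc i) x [] low with low (here refl)
    ... | le rewrite no-loop x with +≤+ () ← le
    forward-triangular (suc i) x (y ∷ L₁) low = begin
      + suc i * (+ 1 + + suc i)             ≡⟨ lemma (+ i) ⟩
      + 2 * (+ 1 + + i) + + i * (+ 1 + + i) ≤⟨ ℤ.+-mono-≤ (ℤ.*-monoˡ-≤-nonNeg (+ 2) dx) (forward-triangular i y L₁ low′) ⟩
      + 2 * deg (y ∷ L₁) x + + 2 * forward (y ∷ L₁) ≡⟨ ℤ.*-distribˡ-+ (+ 2) (deg (y ∷ L₁) x) (forward (y ∷ L₁)) ⟨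
      + 2 * (deg (y ∷ L₁) x + forward (y ∷ L₁)) ∎
      where
      open ℤ.≤-Reasoning
      lemma : ∀ i → (+ 1 + i) * (+ 1 + (+ 1 + i)) ≡ + 2 * (+ 1 + i) + i * (+ 1 + i)
      lemma = solve-∀
      dx : + suc i ≤ deg (y ∷ L₁) x
      dx = subst (+ suc i ≤_) (trans (cong (λ b → ⟦ b ⟧ + deg (y ∷ L₁) x) (no-loop x)) (ℤ.+-identityˡ _))
                 (low (here refl))
      low′ : ∀ {z} → z ∈ y ∷ L₁ → + i ≤ deg (y ∷ L₁) z
      low′ {z} z∈ = +-cancelˡ-≤ (+ 1) (+ i) _ (ℤ.≤-trans (low (there z∈)) (ℤ.+-monoˡ-≤ (deg (y ∷ L₁) z) (⟦⟧≤1 (z ⇒ x))))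

    -- If j is the least out-degree, any order of the vertices has at least j(j + 1)/2 forward arcs.
    -- In the order from `feedback≤nonadjacent` this gives j² ≤ j(j + 1) ≤ ν.
    ∃-deg²≤nonadjacent : ∀ x L → ∃ λ z → z ∈ x ∷ L × deg (x ∷ L) z * deg (x ∷ L) z ≤ nonadjacent (x ∷ L) (x ∷ L)
    ∃-deg²≤nonadjacent x L = low-degree (argmin x L (deg (x ∷ L))) (feedback≤nonadjacent _ (x ∷ L) ℕ.≤-refl)
      where
      low-degree : (∃ λ z → z ∈ x ∷ L × (∀ {y} → y ∈ x ∷ L → deg (x ∷ L) z ≤ deg (x ∷ L) y)) →
        (∃ λ M → M ↭ x ∷ L × + 2 * forward M ≤ nonadjacent (x ∷ L) (x ∷ L)) →
        ∃ λ z → z ∈ x ∷ L × deg (x ∷ L) z * deg (x ∷ L) z ≤ nonadjacent (x ∷ L) (x ∷ L)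
      low-degree _ ([] , p , _) with () ← ↭-length p
      low-degree (z , z∈ , min) (y ∷ M , p , le) =
        z , z∈ , subst (λ d → d * d ≤ nonadjacent (x ∷ L) (x ∷ L)) +j≡ bound
        where
        j = ∣ deg (x ∷ L) z ∣
        +j≡ : + j ≡ deg (x ∷ L) z
        +j≡ = ℤ.0≤i⇒+∣i∣≡i (deg-nonneg (x ∷ L) z)
        bound : + j * + j ≤ nonadjacent (x ∷ L) (x ∷ L)
        bound = begin
          + j * + j              ≤⟨ ℤ.*-monoˡ-≤-nonNeg (+ j) (ℤ.i≤j+i (+ j) (+ 1)) ⟩
          + j * (+ 1 + + j)      ≤⟨ forward-triangular j y M (λ {w} w∈ →
                                      subst₂ _≤_ (sym +j≡) (sym (deg-↭ p w)) (min (∈-resp-↭ p w∈))) ⟩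
          + 2 * forward (y ∷ M)  ≤⟨ le ⟩
          nonadjacent (x ∷ L) (x ∷ L) ∎
          where open ℤ.≤-Reasoning

  -- Tools for the bounds on common out-neighbourhoods

  search-≤ : ∀ (L : List A) (f g : A → ℤ) → (∃ λ z → z ∈ L × f z ≤ g z) ⊎ (∀ {z} → z ∈ L → g z ≤ f z)
  search-≤ []      f g = inj₂ λ ()
  search-≤ (x ∷ L) f g with f x ≤? g x
  ... | yes le = inj₁ (x , here refl , le)
  ... | no  gt with search-≤ L f g
  ...   | inj₁ (z , z∈ , le) = inj₁ (z , there z∈ , le)
  ...   | inj₂ all = inj₂ λ { (here refl) → ℤ.<⇒≤ (ℤ.≰⇒> gt) ; (there z∈) → all z∈ }

  ∑-affine : ∀ (L : List A) a b c f g →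
    ∑ L (λ w → a - b * f w - c * g w) ≡ a * # L - b * ∑ L f - c * ∑ L g
  ∑-affine L a b c f g = begin
    ∑ L (λ w → a - b * f w - c * g w)
      ≡⟨ ∑-cong L (λ w → lemma a b c (f w) (g w)) ⟩
    ∑ L (λ w → a * + 1 + (- b * f w + - c * g w))
      ≡⟨ trans (∑-distrib-+ L _ _) (cong₂ _+_ (∑-*ˡ L a _) (trans (∑-distrib-+ L _ _) (cong₂ _+_ (∑-*ˡ L (- b) f) (∑-*ˡ L (- c) g)))) ⟩
    a * # L + (- b * ∑ L f + - c * ∑ L g)
      ≡⟨ lemma′ a b c (# L) (∑ L f) (∑ L g) ⟩
    a * # L - b * ∑ L f - c * ∑ L g ∎
    where
    open ≡-Reasoning
    lemma : ∀ a b c x y → a - b * x - c * y ≡ a * + 1 + (- b * x + - c * y)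
    lemma = solve-∀
    lemma′ : ∀ a b c n x y → a * n + (- b * x + - c * y) ≡ a * n - b * x - c * y
    lemma′ = solve-∀

  -- Here n, p and q are the sizes of the whole list, of the common out-neighbourhood A and of the
  -- forbidden set; d and e are the out-degrees of one vertex in the list and in A. The summands on
  -- the left are the slacks in `deg-bound`, in the density assumption and in the choice of the
  -- vertex.
  dense-identity : ∀ a b n p q d e → b * (e + n - (d + p + q)) + (b * d - a * n) + (a * p - b * e)
    ≡ (b - a) * n - b * q - (b - a) * p
  dense-identity = solve-∀

  -- Here v is the number of nonadjacent pairs in A. The e² terms cancel, and b = 2kr makes the
  -- mixed term of the square cancel the product b·e·n.
  dense-identity₂ : ∀ a b k r c₂ c₃ n p q v d e → b ≡ + 2 * k * r → c₂ ≡ b - a + k → c₃ ≡ k * (r * r) →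
    (b * (e + n - (d + p + q)) + (b * d - a * n)) * n + k * (r * r * (v - e * e) + (r * e - n) * (r * e - n))
    ≡ (c₂ * n - b * q - b * p) * n + c₃ * v
  dense-identity₂ a _ k r _ _ n p q v d e refl refl refl = identity a k r n p q v d e
    where
    identity : ∀ a k r n p q v d e →
      (+ 2 * k * r * (e + n - (d + p + q)) + (+ 2 * k * r * d - a * n)) * n
      + k * (r * r * (v - e * e) + (r * e - n) * (r * e - n))
      ≡ ((+ 2 * k * r - a + k) * n - + 2 * k * r * q - + 2 * k * r * p) * n + k * (r * r) * v
    identity = solve-∀

  ⟦⟧-bound : ∀ {s p q} → (p ≡ true → q ≡ false) → (s ≡ true → q ≡ false) → ⟦ s ⟧ + ⟦ p ⟧ + ⟦ q ⟧ ≤ ⟦ p ⟧ * ⟦ s ⟧ + + 1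
  ⟦⟧-bound {true}  {_}     {true}  _ av with () ← av refl
  ⟦⟧-bound {false} {true}  {true}  dj _ with () ← dj refl
  ⟦⟧-bound {true}  {true}  {false} _ _ = ℤ.≤-refl
  ⟦⟧-bound {true}  {false} {false} _ _ = ℤ.≤-refl
  ⟦⟧-bound {false} {true}  {false} _ _ = ℤ.≤-refl
  ⟦⟧-bound {false} {false} {true}  _ _ = ℤ.≤-refl
  ⟦⟧-bound {false} {false} {false} _ _ = +≤+ ℕ.z≤n

  -- Sums over quadruples of vertices

  module _ {V : Set} (L : List V) where

    ∑⁴ : (V → V → V → V → ℤ) → ℤ
    ∑⁴ F = ∑ L λ x → ∑ L λ y → ∑ L λ z → ∑ L λ w → F x y z w

    ∑⁴-cong : ∀ {F G} → (∀ x y z w → F x y z w ≡ G x y z w) → ∑⁴ F ≡ ∑⁴ G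
    ∑⁴-cong eq = ∑-cong L λ x → ∑-cong L λ y → ∑-cong L λ z → ∑-cong L λ w → eq x y z w

    ∑⁴-distrib-+ : ∀ F G → ∑⁴ (λ x y z w → F x y z w + G x y z w) ≡ ∑⁴ F + ∑⁴ G
    ∑⁴-distrib-+ F G = trans (∑-cong L λ x → trans (∑-cong L λ y → trans (∑-cong L λ z →
      ∑-distrib-+ L _ _) (∑-distrib-+ L _ _)) (∑-distrib-+ L _ _)) (∑-distrib-+ L _ _)

    ∑⁴-swap₁₂ : ∀ F → ∑⁴ (λ x y z w → F y x z w) ≡ ∑⁴ F
    ∑⁴-swap₁₂ F = ∑-swap L L _

    ∑⁴-swap₂₃ : ∀ F → ∑⁴ (λ x y z w → F x z y w) ≡ ∑⁴ F
    ∑⁴-swap₂₃ F = ∑-cong L λ x → ∑-swap L L _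

    ∑⁴-swap₃₄ : ∀ F → ∑⁴ (λ x y z w → F x y w z) ≡ ∑⁴ F
    ∑⁴-swap₃₄ F = ∑-cong L λ x → ∑-cong L λ y → ∑-swap L L _

  -- Symmetrisation over the orders of four vertices

  module TriangleFreeDensity {V : Set} (_⇒_ : V → V → Bool)
    (no-digon : ∀ {u v} → u ⇒ v ≡ true → v ⇒ u ≡ true → ⊥)
    (no-triangle : ∀ {u v w} → u ⇒ v ≡ true → v ⇒ w ≡ true → w ⇒ u ≡ true → ⊥) where

    open TriangleFree _⇒_ no-digon no-triangle

    at : Config A → V → V → V → V → A
    at F x y z w = F (link x y) (link x z) (link x w) (link y z) (link y w) (link z w)

    cyclic-false : ∀ x y z → cyclic (link x y) (link y z) (link x z) ≡ false
    cyclic-false x y z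
      rewrite isFwd-link x y | isFwd-link y z | isBwd-link x z | isBwd-link x y | isBwd-link y z | isFwd-link x z
      with x ⇒ y in xy | y ⇒ z in yz | z ⇒ x in zx | y ⇒ x in yx | z ⇒ y in zy | x ⇒ z in xz
    ... | true  | true  | true  | _     | _     | _     = ⊥-elim (no-triangle xy yz zx)
    ... | _     | _     | _     | true  | true  | true  = ⊥-elim (no-triangle xz zy yx)
    ... | true  | true  | false | true  | true  | false = refl
    ... | true  | true  | false | true  | false | _     = refl
    ... | true  | true  | false | false | _     | _     = refl
    ... | true  | false | _     | true  | true  | false = refl
    ... | true  | false | _     | true  | false | _     = refl
    ... | true  | false | _     | false | _     | _     = refl
    ... | false | _     | _     | true  | true  | false = refl
    ... | false | _     | _     | true  | false | _     = refl
    ... | false | _     | _     | false | _     | _     = refl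

    hasTriangle-false : ∀ x y z w → at hasTriangle x y z w ≡ false
    hasTriangle-false x y z w
      rewrite cyclic-false x y z | cyclic-false x y w | cyclic-false x z w | cyclic-false y z w = refl

    module _ (L : List V) where

      private
        S : Config ℤ → ℤ
        S F = ∑⁴ L (at F)

      ∑-sym₂ : ∀ F → S (sym₂ F) ≡ + 2 * S F
      ∑-sym₂ F = begin
        S (sym₂ F)
          ≡⟨ ∑⁴-cong L (λ x y z w → cong (λ a → at F x y z w + F a (link y z) (link y w) (link x z) (link x w) (link z w)) (sym (link-flip x y))) ⟩
        ∑⁴ L (λ x y z w → at F x y z w + at F y x z w)
          ≡⟨ ∑⁴-distrib-+ L _ _ ⟩
        S F + ∑⁴ L (λ x y z w → at F y x z w)
          ≡⟨ cong (λ s → S F + s) (∑⁴-swap₁₂ L (at F)) ⟩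
        S F + S F ≡⟨ lemma (S F) ⟩
        + 2 * S F ∎
        where
        open ≡-Reasoning
        lemma : ∀ a → a + a ≡ + 2 * a
        lemma = solve-∀

      ∑-sym₃ : ∀ F → S (sym₃ F) ≡ + 3 * S F
      ∑-sym₃ F = begin
        S (sym₃ F)
          ≡⟨ ∑⁴-cong L pointwise ⟩
        ∑⁴ L (λ x y z w → at F x y z w + at F x z y w + at F y z x w)
          ≡⟨ trans (∑⁴-distrib-+ L _ _) (cong (λ s → s + ∑⁴ L (λ x y z w → at F y z x w)) (∑⁴-distrib-+ L _ _)) ⟩
        S F + ∑⁴ L (λ x y z w → at F x z y w) + ∑⁴ L (λ x y z w → at F y z x w)
          ≡⟨ cong₂ (λ s t → S F + s + t) (∑⁴-swap₂₃ L (at F))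
                   (trans (∑⁴-swap₁₂ L (λ x y z w → at F x z y w)) (∑⁴-swap₂₃ L (at F))) ⟩
        S F + S F + S F ≡⟨ lemma (S F) ⟩
        + 3 * S F ∎
        where
        open ≡-Reasoning
        lemma : ∀ a → a + a + a ≡ + 3 * a
        lemma = solve-∀
        pointwise : ∀ x y z w → at (sym₃ F) x y z w ≡ at F x y z w + at F x z y w + at F y z x w
        pointwise x y z w rewrite link-flip y z | link-flip x y | link-flip x z = refl

      ∑-sym₄ : ∀ F → S (sym₄ F) ≡ + 4 * S F
      ∑-sym₄ F = begin
        S (sym₄ F)
          ≡⟨ ∑⁴-cong L pointwise ⟩
        ∑⁴ L (λ x y z w → at F x y z w + at F x y w z + at F x z w y + at F y z w x)
          ≡⟨ trans (∑⁴-distrib-+ L _ _) (cong (λ s → s + ∑⁴ L (λ x y z w → at F y z w x))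
               (trans (∑⁴-distrib-+ L _ _) (cong (λ s → s + ∑⁴ L (λ x y z w → at F x z w y)) (∑⁴-distrib-+ L _ _)))) ⟩
        S F + ∑⁴ L (λ x y z w → at F x y w z) + ∑⁴ L (λ x y z w → at F x z w y) + ∑⁴ L (λ x y z w → at F y z w x)
          ≡⟨ cong₂ (λ s t → s + t) (cong₂ (λ s t → S F + s + t) (∑⁴-swap₃₄ L (at F)) rotate₃) rotate₄ ⟩
        S F + S F + S F + S F ≡⟨ lemma (S F) ⟩
        + 4 * S F ∎
        where
        open ≡-Reasoning
        lemma : ∀ a → a + a + a + a ≡ + 4 * a
        lemma = solve-∀
        rotate₃ : ∑⁴ L (λ x y z w → at F x z w y) ≡ S F
        rotate₃ = trans (∑⁴-swap₂₃ L (λ x y z w → at F x y w z)) (∑⁴-swap₃₄ L (at F))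
        rotate₄ : ∑⁴ L (λ x y z w → at F y z w x) ≡ S F
        rotate₄ = trans (∑⁴-swap₁₂ L (λ x y z w → at F x z w y)) rotate₃
        pointwise : ∀ x y z w → at (sym₄ F) x y z w ≡ at F x y z w + at F x y w z + at F x z w y + at F y z w x
        pointwise x y z w rewrite link-flip z w | link-flip y z | link-flip y w | link-flip x y | link-flip x z | link-flip x w = refl

    -- Summing over all quadruples is invariant under permuting the four variables, so symmetrising
    -- multiplies the sum by 24. Quadruples with repeated vertices are included; they too contain no
    -- cyclic triangle.
    ∑-negative : ∀ F → NegativeOnTriangleFree (sym₄ (sym₃ (sym₂ F))) → ∀ x L → ∑⁴ (x ∷ L) (at F) < 0ℤ
    ∑-negative F negative x L = ℤ.*-cancelˡ-<-nonNeg (+ 24) (begin-strict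
      + 24 * S F                           ≡⟨ lemma (S F) ⟩
      + 4 * (+ 3 * (+ 2 * S F))            ≡⟨ cong (λ s → + 4 * (+ 3 * s)) (∑-sym₂ M F) ⟨
      + 4 * (+ 3 * S (sym₂ F))             ≡⟨ cong (λ s → + 4 * s) (∑-sym₃ M (sym₂ F)) ⟨
      + 4 * S (sym₃ (sym₂ F))              ≡⟨ ∑-sym₄ M (sym₃ (sym₂ F)) ⟨
      S (sym₄ (sym₃ (sym₂ F)))
        ≤⟨ ∑-≤-negative (λ x → ∑-≤-negative (λ y → ∑-≤-negative (λ z → ∑-≤-negative (λ w →
             negative (link x y) (link x z) (link x w) (link y z) (link y w) (link z w) (hasTriangle-false x y z w))))) ⟩
      - + 1                                <⟨ -<+ ⟩
      0ℤ                                   ∎)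
      where
      open ℤ.≤-Reasoning
      M = x ∷ L
      S : Config ℤ → ℤ
      S F = ∑⁴ M (at F)
      lemma : ∀ a → + 24 * a ≡ + 4 * (+ 3 * (+ 2 * a))
      lemma = solve-∀
      -- One entry, present because the list is nonempty, contributes at most -1; the others
      -- contribute at most 0.
      ∑-≤-negative : ∀ {f : V → ℤ} → (∀ y → f y ≤ - + 1) → ∑ M f ≤ - + 1
      ∑-≤-negative {f} le = ℤ.+-mono-≤ (le x) (ℤ.≤-trans (∑-mono L (λ {y} _ → ℤ.≤-trans (le y) -≤+))
        (ℤ.≤-reflexive (∑-const L 0ℤ)))

    ∑-certificate<0 : ∀ x L → ∑⁴ (x ∷ L) (at certificate) < 0ℤ
    ∑-certificate<0 = ∑-negative certificate symmetrised-negative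

    -- The vertices marked by p form a common out-neighbourhood; those marked by q cannot be
    -- out-neighbours of its members.  The square (r e − N)² ≥ 0 makes the bound e² ≤ ν on the smallest
    -- out-degree e linear.
    module Dense (a b k r c₁ c₂ c₃ : ℤ)
      (b≡ : b ≡ + 2 * k * r) (c₁≡ : c₁ ≡ b - a) (c₂≡ : c₂ ≡ b - a + k) (c₃≡ : c₃ ≡ k * (r * r))
      (b≥0 : 0ℤ ≤ b) (k≥0 : 0ℤ ≤ k)
      (L : List V)
      (ih : ∀ M → length M ℕ.< length L → ∀ {v} → v ∈ M → ∃ λ z → z ∈ M × b * deg M z ≤ a * # M)
      (dense : ∀ {z} → z ∈ L → a * # L ≤ b * deg L z) where

      -- The set marked by `q` is disjoint from the out-neighbourhood of `z` and from the set marked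
      -- by `p`, so only those two overlap, in the out-neighbours counted on the right.
      deg-bound : ∀ (p q : V → Bool) z → (∀ w → p w ≡ true → q w ≡ false) → (∀ w → z ⇒ w ≡ true → q w ≡ false) →
        deg L z + ∑ L (⟦_⟧ ∘ p) + ∑ L (⟦_⟧ ∘ q) ≤ deg (filterᵇ p L) z + # L
      deg-bound p q z disjoint avoids = begin
        deg L z + ∑ L (⟦_⟧ ∘ p) + ∑ L (⟦_⟧ ∘ q)
          ≡⟨ trans (∑-distrib-+ L _ _) (cong (λ s → s + ∑ L (⟦_⟧ ∘ q)) (∑-distrib-+ L _ _)) ⟨
        ∑ L (λ w → ⟦ z ⇒ w ⟧ + ⟦ p w ⟧ + ⟦ q w ⟧)
          ≤⟨ ∑-mono L (λ {w} _ → ⟦⟧-bound (disjoint w) (avoids w)) ⟩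
        ∑ L (λ w → ⟦ p w ⟧ * ⟦ z ⇒ w ⟧ + + 1)
          ≡⟨ trans (∑-distrib-+ L _ _) (cong (λ s → s + # L) (sym (∑-filter p L _))) ⟩
        deg (filterᵇ p L) z + # L ∎
        where open ℤ.≤-Reasoning

      module _ (p q : V → Bool) {u z₀ : V} (u∈L : u ∈ L) (z₀∈L : z₀ ∈ L) (u∉p : p u ≡ false)
        (disjoint : ∀ w → p w ≡ true → q w ≡ false)
        (avoids₀ : ∀ w → z₀ ⇒ w ≡ true → q w ≡ false)
        (avoids : ∀ z → p z ≡ true → ∀ w → z ⇒ w ≡ true → q w ≡ false) where

        private
          F : List V
          F = filterᵇ p L
          N P Q ν : ℤ
          N = # L
          P = ∑ L (⟦_⟧ ∘ p)
          Q = ∑ L (⟦_⟧ ∘ q)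
          ν = nonadjacent F F

        -- The vertex `z₀` is the fallback when no vertex is marked by `p`. The vertex `u` makes the
        -- marked list strictly shorter, as induction requires.
        ∃-avoiding : (Φ : List V → V → Set) → (∀ z → Φ [] z) →
          (∀ v M → length (v ∷ M) ℕ.< length L → ∃ λ z → z ∈ v ∷ M × Φ (v ∷ M) z) →
          ∃ λ z → z ∈ L × (∀ w → z ⇒ w ≡ true → q w ≡ false) × Φ F z
        ∃-avoiding Φ empty pick = go F refl
          where
          go : ∀ M → F ≡ M → ∃ λ z → z ∈ L × (∀ w → z ⇒ w ≡ true → q w ≡ false) × Φ M z
          go []      eq = z₀ , z₀∈L , avoids₀ , empty z₀
          go (v ∷ M) eq =
            let z , z∈ , φ = pick v M (subst (λ X → length X ℕ.< length L) eq (length-filterᵇ-< p L u∈L u∉p))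
                z∈L , pz   = ∈-filterᵇ⁻ p L (subst (z ∈_) (sym eq) z∈)
            in z , z∈L , avoids z pz , φ

        0≤dense-sum : 0ℤ ≤ ∑ L (λ w → c₁ - b * ⟦ q w ⟧ - c₁ * ⟦ p w ⟧)
        0≤dense-sum = subst (0ℤ ≤_) (sym (trans (∑-affine L c₁ b c₁ _ _) (cong (λ c → c * N - b * Q - c * P) c₁≡)))
          (bound (∃-avoiding (λ M z → b * deg M z ≤ a * # M)
                   (λ _ → ℤ.≤-reflexive (trans (ℤ.*-zeroʳ b) (sym (ℤ.*-zeroʳ a))))
                   (λ v M len → ih (v ∷ M) len (here refl))))
          where
          bound : (∃ λ z → z ∈ L × (∀ w → z ⇒ w ≡ true → q w ≡ false) × b * deg F z ≤ a * # F) →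
                  0ℤ ≤ (b - a) * N - b * Q - (b - a) * P
          bound (z , z∈ , av , le) = subst (0ℤ ≤_) (dense-identity a b N P Q (deg L z) (deg F z))
            (0≤+ (0≤+ (0≤* {b} b≥0 (ℤ.i≤j⇒0≤j-i (deg-bound p q z disjoint av)))
                      (ℤ.i≤j⇒0≤j-i (dense z∈)))
                 (ℤ.i≤j⇒0≤j-i (subst (λ s → b * deg F z ≤ a * s) (#-filter p L) le)))

        0≤dense-sum₂ : 0ℤ ≤ ∑ L (λ z → ∑ L (λ w → c₂ - b * ⟦ q w ⟧ - b * ⟦ p w ⟧
                                                 + c₃ * (⟦ p z ⟧ * (⟦ p w ⟧ * ⟦ z ∥ w ⟧))))
        0≤dense-sum₂ = subst (0ℤ ≤_) (sym expand)
          (bound (∃-avoiding (λ M z → deg M z * deg M z ≤ nonadjacent M M) (λ _ → ℤ.≤-refl)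
                   (λ v M _ → ∃-deg²≤nonadjacent v M)))
          where
          expand : ∑ L (λ z → ∑ L (λ w → c₂ - b * ⟦ q w ⟧ - b * ⟦ p w ⟧ + c₃ * (⟦ p z ⟧ * (⟦ p w ⟧ * ⟦ z ∥ w ⟧))))
                   ≡ (c₂ * N - b * Q - b * P) * N + c₃ * ν
          expand = trans (∑-cong L (λ z → ∑-distrib-+ L linear (quadratic z)))
            (trans (∑-distrib-+ L (λ _ → ∑ L linear) (λ z → ∑ L (quadratic z)))
            (cong₂ _+_ (trans (∑-const L (∑ L linear)) (cong (λ s → s * N) (∑-affine L c₂ b b (⟦_⟧ ∘ q) (⟦_⟧ ∘ p))))
                       (trans (∑-cong L (λ z → ∑-*ˡ L c₃ (λ w → ⟦ p z ⟧ * (⟦ p w ⟧ * ⟦ z ∥ w ⟧))))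
                              (trans (∑-*ˡ L c₃ _) (cong (λ s → c₃ * s) (sym (∑∑-filter p p L _)))))))
            where
            linear : V → ℤ
            linear w = c₂ - b * ⟦ q w ⟧ - b * ⟦ p w ⟧
            quadratic : V → V → ℤ
            quadratic z w = c₃ * (⟦ p z ⟧ * (⟦ p w ⟧ * ⟦ z ∥ w ⟧))
          bound : (∃ λ z → z ∈ L × (∀ w → z ⇒ w ≡ true → q w ≡ false) × deg F z * deg F z ≤ ν) →
                  0ℤ ≤ (c₂ * N - b * Q - b * P) * N + c₃ * ν
          bound (z , z∈ , av , le) = subst (0ℤ ≤_)
            (dense-identity₂ a b k r c₂ c₃ N P Q ν (deg L z) (deg F z) b≡ c₂≡ c₃≡)
            (0≤+ (0≤* {_} {N} (0≤+ (0≤* {b} b≥0 (ℤ.i≤j⇒0≤j-i (deg-bound p q z disjoint av)))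
                                   (ℤ.i≤j⇒0≤j-i (dense z∈)))
                              (∑-nonneg L (λ _ → +≤+ ℕ.z≤n)))
                 (0≤* {k} k≥0 (0≤+ (0≤* {r * r} (0≤square r) (ℤ.i≤j⇒0≤j-i le))
                                   (0≤square (r * deg F z - N)))))

  -- The minimum out-degree of a triangle-free digraph

  ≢true⇒false : ∀ {b} → (b ≡ true → ⊥) → b ≡ false
  ≢true⇒false {true}  ¬t = ⊥-elim (¬t refl)
  ≢true⇒false {false} _  = refl

  ∧-true⁻ : ∀ {a b} → a ∧ b ≡ true → a ≡ true × b ≡ true
  ∧-true⁻ {true} eq = refl , eq

  ∨-false⁺ : ∀ {a b} → a ≡ false → b ≡ false → a ∨ b ≡ false
  ∨-false⁺ refl eq = eq

  0≤⟦⟧* : ∀ b {i} → (b ≡ true → 0ℤ ≤ i) → 0ℤ ≤ ⟦ b ⟧ * i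
  0≤⟦⟧* true  {i} nn = subst (0ℤ ≤_) (sym (ℤ.*-identityˡ i)) (nn refl)
  0≤⟦⟧* false     nn = ℤ.≤-refl

  module _ {V : Set} (_⇒_ : V → V → Bool)
    (no-digon : ∀ {u v} → u ⇒ v ≡ true → v ⇒ u ≡ true → ⊥)
    (no-triangle : ∀ {u v w} → u ⇒ v ≡ true → v ⇒ w ≡ true → w ⇒ u ≡ true → ⊥) where

    open TriangleFree _⇒_ no-digon no-triangle
    open TriangleFreeDensity _⇒_ no-digon no-triangle

    module _ (L : List V) where

      ∑-squareTerm≥0 : ∀ {m} φ x y → 0ℤ ≤ m → 0ℤ ≤ ∑ L (λ z → ∑ L (at (squareTerm m φ) x y z))
      ∑-squareTerm≥0 {m} φ x y m≥0 = subst (0ℤ ≤_) (sym eq)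
        (0≤* (0≤* m≥0 (0≤⟦⟧ (isFwd (link x y)))) (0≤square (∑ L value)))
        where
        value : V → ℤ
        value z = φ (link x z) (link y z)
        eq : ∑ L (λ z → ∑ L (at (squareTerm m φ) x y z)) ≡ m * ⟦ isFwd (link x y) ⟧ * (∑ L value * ∑ L value)
        eq = trans (∑-cong L (λ z → ∑-*ˡ L (m * ⟦ isFwd (link x y) ⟧) _))
          (trans (∑-*ˡ L (m * ⟦ isFwd (link x y) ⟧) _)
                 (cong (λ s → m * ⟦ isFwd (link x y) ⟧ * s) (∑-pairs-* L L value value)))

    module _ (a b k r c₁ c₂ c₃ : ℤ)
      (b≡ : b ≡ + 2 * k * r) (c₁≡ : c₁ ≡ b - a) (c₂≡ : c₂ ≡ b - a + k) (c₃≡ : c₃ ≡ k * (r * r))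
      (b≥0 : 0ℤ ≤ b) (k≥0 : 0ℤ ≤ k) (L : List V)
      (ih : ∀ M → length M ℕ.< length L → ∀ {v} → v ∈ M → ∃ λ z → z ∈ M × b * deg M z ≤ a * # M)
      (dense : ∀ {z} → z ∈ L → a * # L ≤ b * deg L z) where

      open Dense a b k r c₁ c₂ c₃ b≡ c₁≡ c₂≡ c₃≡ b≥0 k≥0 L ih dense

      ∑-degreeTerm≥0 : ∀ {x y z} → x ∈ L → 0ℤ ≤ ∑ L (at (degreeTerm a b) x y z)
      ∑-degreeTerm≥0 {x} {y} {z} x∈ = subst (0ℤ ≤_) (sym eq)
        (0≤* {+ ψ (link x y) (link x z) (link y z)} (+≤+ ℕ.z≤n) (ℤ.i≤j⇒0≤j-i (dense x∈)))
        where
        lemma : ∀ b a i → b * i - a ≡ b * i + - a * + 1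
        lemma = solve-∀
        lemma′ : ∀ i a n → i + - a * n ≡ i - a * n
        lemma′ = solve-∀
        eq : ∑ L (at (degreeTerm a b) x y z) ≡ + ψ (link x y) (link x z) (link y z) * (b * deg L x - a * # L)
        eq = trans (∑-*ˡ L (+ ψ (link x y) (link x z) (link y z)) (λ w → b * ⟦ isFwd (link x w) ⟧ - a))
          (cong (λ s → + ψ (link x y) (link x z) (link y z) * s)
            (trans (∑-cong L (λ w → trans (cong (λ c → b * ⟦ c ⟧ - a) (isFwd-link x w)) (lemma b a ⟦ x ⇒ w ⟧)))
            (trans (∑-distrib-+ L (λ w → b * ⟦ x ⇒ w ⟧) (λ w → - a * + 1))
            (trans (cong₂ _+_ (∑-*ˡ L b (λ w → ⟦ x ⇒ w ⟧)) (∑-*ˡ L (- a) (λ w → + 1)))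
                   (lemma′ (b * deg L x) a (# L))))))

      ∑-tripleTerm≥0 : ∀ {x y z} → x ∈ L → z ∈ L → 0ℤ ≤ ∑ L (at (tripleTerm b c₁) x y z)
      ∑-tripleTerm≥0 {x} {y} {z} x∈ z∈ = subst (0ℤ ≤_) (sym eq)
        (subst (0ℤ ≤_) (sym (ℤ.*-assoc (+ σ (link x y)) _ _))
          (0≤* {+ σ (link x y)} (+≤+ ℕ.z≤n) (0≤⟦⟧* (x ⇒ z ∧ y ⇒ z) λ both → let xz , yz = ∧-true⁻ both in
            0≤dense-sum p q x∈ z∈ x∉p
              (λ w pw → let xw , yzw = ∧-true⁻ pw ; yw , zw = ∧-true⁻ yzw in
                none-of (no-digon xw) (no-digon yw) (no-digon zw))
              -- The fallback is `z`, a common out-neighbour of `x` and `y`: an arc from its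
              -- out-neighbour `w` back to one of the three would close a triangle or a 2-cycle.
              (λ w zw → none-of (no-triangle xz zw) (no-triangle yz zw) (no-digon zw))
              (λ v pv w vw → let xv , yzv = ∧-true⁻ pv ; yv , zv = ∧-true⁻ yzv in
                none-of (no-triangle xv vw) (no-triangle yv vw) (no-triangle zv vw)))))
        where
        p q : V → Bool
        p w = x ⇒ w ∧ y ⇒ w ∧ z ⇒ w
        q w = w ⇒ x ∨ w ⇒ y ∨ w ⇒ z
        x∉p : p x ≡ false
        x∉p rewrite no-loop x = refl
        none-of : ∀ {a b c} → (a ≡ true → ⊥) → (b ≡ true → ⊥) → (c ≡ true → ⊥) → a ∨ b ∨ c ≡ false
        none-of ¬a ¬b ¬c = ∨-false⁺ (≢true⇒false ¬a) (∨-false⁺ (≢true⇒false ¬b) (≢true⇒false ¬c))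
        weight : Bool → Bool → ℤ
        weight s t = c₁ - b * ⟦ s ⟧ - c₁ * ⟦ t ⟧
        eq : ∑ L (at (tripleTerm b c₁) x y z) ≡ + σ (link x y) * ⟦ x ⇒ z ∧ y ⇒ z ⟧ * ∑ L (λ w → weight (q w) (p w))
        eq = trans (∑-*ˡ L (+ σ (link x y) * ⟦ isFwd (link x z) ∧ isFwd (link y z) ⟧)
               (λ w → weight (isBwd (link x w) ∨ isBwd (link y w) ∨ isBwd (link z w))
                             (isFwd (link x w) ∧ isFwd (link y w) ∧ isFwd (link z w))))
          (cong₂ (λ t s → + σ (link x y) * ⟦ t ⟧ * s) (cong₂ _∧_ (isFwd-link x z) (isFwd-link y z))
            (∑-cong L (λ w → cong₂ weight
              (cong₂ _∨_ (isBwd-link x w) (cong₂ _∨_ (isBwd-link y w) (isBwd-link z w)))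
              (cong₂ _∧_ (isFwd-link x w) (cong₂ _∧_ (isFwd-link y w) (isFwd-link z w))))))

      ∑-pairTerm≥0 : ∀ {m x y} → 0ℤ ≤ m → x ∈ L → y ∈ L → 0ℤ ≤ ∑ L (λ z → ∑ L (at (pairTerm m b c₂ c₃) x y z))
      ∑-pairTerm≥0 {m} {x} {y} m≥0 x∈ y∈ = subst (0ℤ ≤_) (sym eq)
        (subst (0ℤ ≤_) (sym (ℤ.*-assoc m _ _))
          (0≤* {m} m≥0 (0≤⟦⟧* (x ⇒ y) λ xy →
            0≤dense-sum₂ p q x∈ y∈ x∉p
              (λ w pw → let xw , yw = ∧-true⁻ pw in none-of (no-digon xw) (no-digon yw))
              -- Here the fallback is `y`, using the arc x → y.
              (λ w yw → none-of (no-triangle xy yw) (no-digon yw))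
              (λ v pv w vw → let xv , yv = ∧-true⁻ pv in none-of (no-triangle xv vw) (no-triangle yv vw)))))
        where
        p q : V → Bool
        p w = x ⇒ w ∧ y ⇒ w
        q w = w ⇒ x ∨ w ⇒ y
        x∉p : p x ≡ false
        x∉p rewrite no-loop x = refl
        none-of : ∀ {a b} → (a ≡ true → ⊥) → (b ≡ true → ⊥) → a ∨ b ≡ false
        none-of ¬a ¬b = ∨-false⁺ (≢true⇒false ¬a) (≢true⇒false ¬b)
        weight : Bool → Bool → Bool → Bool → ℤ
        weight s t t′ n = c₂ - b * ⟦ s ⟧ - b * ⟦ t ⟧ + c₃ * (⟦ t′ ⟧ * (⟦ t ⟧ * ⟦ n ⟧))
        both : V → Bool
        both w = isFwd (link x w) ∧ isFwd (link y w)
        both≡ : ∀ w → both w ≡ p w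
        both≡ w = cong₂ _∧_ (isFwd-link x w) (isFwd-link y w)
        eq : ∑ L (λ z → ∑ L (at (pairTerm m b c₂ c₃) x y z))
             ≡ m * ⟦ x ⇒ y ⟧ * ∑ L (λ z → ∑ L (λ w → weight (q w) (p w) (p z) (z ∥ w)))
        eq = trans (∑-cong L (λ z → ∑-*ˡ L (m * ⟦ isFwd (link x y) ⟧)
                     (λ w → weight (isBwd (link x w) ∨ isBwd (link y w)) (both w) (both z) (z ∥ w))))
          (trans (∑-*ˡ L (m * ⟦ isFwd (link x y) ⟧) _)
          (cong₂ (λ t s → m * ⟦ t ⟧ * s) (isFwd-link x y)
            (∑-cong L (λ z → ∑-cong L (λ w → trans
              (cong₂ (λ s t → weight s t (both z) (z ∥ w)) (cong₂ _∨_ (isBwd-link x w) (isBwd-link y w)) (both≡ w))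
              (cong (λ t → weight (q w) (p w) t (z ∥ w)) (both≡ z)))))))

      ∑-terms≥0 : ∀ m l₁ l₂ l₃ χ₁ χ₂ χ₃ → 0ℤ ≤ m → 0ℤ ≤ l₁ → 0ℤ ≤ l₂ → 0ℤ ≤ l₃ →
        0ℤ ≤ ∑⁴ L (at (degreeTerm a b ⊕ tripleTerm b c₁ ⊕ pairTerm m b c₂ c₃
                       ⊕ squareTerm l₁ χ₁ ⊕ squareTerm l₂ χ₂ ⊕ squareTerm l₃ χ₃))
      ∑-terms≥0 m l₁ l₂ l₃ χ₁ χ₂ χ₃ m≥0 l₁≥0 l₂≥0 l₃≥0 =
        plus {degreeTerm a b ⊕ tripleTerm b c₁ ⊕ pairTerm m b c₂ c₃ ⊕ squareTerm l₁ χ₁ ⊕ squareTerm l₂ χ₂} {squareTerm l₃ χ₃}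
          (plus {degreeTerm a b ⊕ tripleTerm b c₁ ⊕ pairTerm m b c₂ c₃ ⊕ squareTerm l₁ χ₁} {squareTerm l₂ χ₂}
          (plus {degreeTerm a b ⊕ tripleTerm b c₁ ⊕ pairTerm m b c₂ c₃} {squareTerm l₁ χ₁}
          (plus {degreeTerm a b ⊕ tripleTerm b c₁} {pairTerm m b c₂ c₃}
          (plus {degreeTerm a b} {tripleTerm b c₁}
          (∑-nonneg L (λ {x} x∈ → ∑-nonneg L (λ {y} _ → ∑-nonneg L (λ {z} _ → ∑-degreeTerm≥0 {x} {y} {z} x∈))))
          (∑-nonneg L (λ {x} x∈ → ∑-nonneg L (λ {y} _ → ∑-nonneg L (λ {z} z∈ → ∑-tripleTerm≥0 {x} {y} {z} x∈ z∈)))))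
          (∑-nonneg L (λ {x} x∈ → ∑-nonneg L (λ {y} y∈ → ∑-pairTerm≥0 m≥0 x∈ y∈))))
          (squares χ₁ l₁≥0)) (squares χ₂ l₂≥0)) (squares χ₃ l₃≥0)
        where
        plus : ∀ {F G} → 0ℤ ≤ ∑⁴ L (at F) → 0ℤ ≤ ∑⁴ L (at G) → 0ℤ ≤ ∑⁴ L (at (F ⊕ G))
        plus {F} {G} f g = subst (0ℤ ≤_) (sym (∑⁴-distrib-+ L (at F) (at G))) (0≤+ f g)
        squares : ∀ {l} χ → 0ℤ ≤ l → 0ℤ ≤ ∑⁴ L (at (squareTerm l χ))
        squares χ l≥0 = ∑-nonneg L (λ {x} _ → ∑-nonneg L (λ {y} _ → ∑-squareTerm≥0 L χ x y l≥0))

    -- Induction on the bound `n`. If no vertex has low out-degree, the terms of the certificate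
    -- have nonnegative sums, while their total is negative.
    ∃-lowDegree : ∀ n L → length L ℕ.≤ n → ∀ {v} → v ∈ L → ∃ λ z → z ∈ L × + 2000 * deg L z ≤ + 693 * # L
    ∃-lowDegree (suc n) L@(v ∷ L′) len _ with search-≤ L (λ z → + 2000 * deg L z) (λ z → + 693 * # L)
    ... | inj₁ found = found
    ... | inj₂ dense = ⊥-elim (ℤ.<-irrefl refl (ℤ.≤-<-trans
        (∑-terms≥0 (+ 693) (+ 2000) (+ 40) (+ 25) (+ 1307) (+ 1347) (+ 25000)
          refl refl refl refl (+≤+ ℕ.z≤n) (+≤+ ℕ.z≤n)
          L (λ M lt → ∃-lowDegree n M (ℕ.s≤s⁻¹ (ℕ.≤-trans lt len))) dense
          (+ 66) (+ 2274) (+ 345) (+ 33) φ₁ φ₂ φ₃ (+≤+ ℕ.z≤n) (+≤+ ℕ.z≤n) (+≤+ ℕ.z≤n) (+≤+ ℕ.z≤n))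
        (∑-certificate<0 v L′)))

    ∃-lowOutDegree : ∀ x L → ∃ λ z → z ∈ x ∷ L × 2000 ℕ.* length (filterᵇ (z ⇒_) (x ∷ L)) ℕ.≤ 693 ℕ.* length (x ∷ L)
    ∃-lowOutDegree x L =
      let z , z∈ , le = ∃-lowDegree _ (x ∷ L) ℕ.≤-refl (here refl)
      in z , z∈ , convert 2000 693 (deg≡length (x ∷ L) z) (#≡length (x ∷ L)) le
      where
      convert : ∀ b a {i j m n} → i ≡ + m → j ≡ + n → + b * i ≤ + a * j → b ℕ.* m ℕ.≤ a ℕ.* n
      convert b a {m = m} {n} refl refl le = ℤ.drop‿+≤+ (subst₂ _≤_ (sym (ℤ.pos-* b m)) (sym (ℤ.pos-* a n)) le)

module Paths where

  open import Data.Nat using (ℕ; zero; suc; _+_; _*_; _∸_; _≤_; _<_; z≤n; s≤s; s≤s⁻¹; _<?_)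
  open import Data.Nat.Properties
  open import Data.Nat.Tactic.RingSolver using (solve-∀)
  open Density using (∈-filterᵇ⁺)

  -- Lists, chains and cycles

  search : ∀ {P : A → Set} → Decidable P → ∀ xs → (∃ λ x → x ∈ xs × P x) ⊎ (∀ {x} → x ∈ xs → ¬ P x)
  search P? [] = inj₂ λ ()
  search P? (x ∷ xs) with P? x
  ... | yes px = inj₁ (x , here refl , px)
  ... | no ¬px with search P? xs
  ...   | inj₁ (y , y∈ , py) = inj₁ (y , there y∈ , py)
  ...   | inj₂ none = inj₂ λ { (here refl) → ¬px ; (there y∈) → none y∈ }

  searchFirst : ∀ {P : A → Set} → Decidable P → ∀ xs →
    (∃ λ ys → ∃ λ z → ∃ λ zs → xs ≡ ys ++ z ∷ zs × P z × (∀ {y} → y ∈ ys → ¬ P y)) ⊎ (∀ {x} → x ∈ xs → ¬ P x)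
  searchFirst P? [] = inj₂ λ ()
  searchFirst P? (x ∷ xs) with P? x
  ... | yes px = inj₁ ([] , x , xs , refl , px , λ ())
  ... | no ¬px with searchFirst P? xs
  ...   | inj₁ (ys , z , zs , refl , pz , none) =
          inj₁ (x ∷ ys , z , zs , refl , pz , λ { (here refl) → ¬px ; (there y∈) → none y∈ })
  ...   | inj₂ none = inj₂ λ { (here refl) → ¬px ; (there y∈) → none y∈ }

  Unique-resp-↭ : ∀ {xs ys : List A} → xs ↭ ys → Unique xs → Unique ys
  Unique-resp-↭ {A} p = PermutationProperties.Unique-resp-↭ (setoid A) (↭⇒↭ₛ p)

  Unique-++⁻ʳ : ∀ (xs : List A) {ys} → Unique (xs ++ ys) → Unique ys
  Unique-++⁻ʳ []       u       = u
  Unique-++⁻ʳ (x ∷ xs) (_ ∷ u) = Unique-++⁻ʳ xs u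

  Unique-disjoint : ∀ (xs : List A) {ys} → Unique (xs ++ ys) → ∀ {z} → z ∈ xs → z ∉ ys
  Unique-disjoint (x ∷ xs) (x∉ ∷ u) (here refl) z∈ys = All.lookup x∉ (∈-++⁺ʳ xs z∈ys) refl
  Unique-disjoint (x ∷ xs) (x∉ ∷ u) (there z∈)  z∈ys = Unique-disjoint xs u z∈ z∈ys

  ∉⇒Unique-∷ : ∀ {x : A} {xs} → x ∉ xs → Unique xs → Unique (x ∷ xs)
  ∉⇒Unique-∷ x∉ u = All.tabulate (λ { y∈ refl → x∉ y∈ }) ∷ u

  Unique-∷ʳ : ∀ {x : A} {xs} → x ∉ xs → Unique xs → Unique (xs ++ x ∷ [])
  Unique-∷ʳ {x = x} {xs} x∉ u = Unique-resp-↭ (++-comm (x ∷ []) xs) (∉⇒Unique-∷ x∉ u)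

  Unique-⊆⇒length≤ : ∀ {xs ys : List A} → Unique xs → (∀ {x} → x ∈ xs → x ∈ ys) → length xs ≤ length ys
  Unique-⊆⇒length≤ {xs = []} u sub = z≤n
  Unique-⊆⇒length≤ {xs = x ∷ xs} {ys} (x∉ ∷ u) sub with ∈-∃++ (sub (here refl))
  ... | as , bs , refl = begin
    suc (length xs)        ≤⟨ s≤s (Unique-⊆⇒length≤ u sub′) ⟩
    suc (length (as ++ bs)) ≡⟨ ↭-length (shift x as bs) ⟨
    length (as ++ x ∷ bs)  ∎
    where
    open ≤-Reasoning
    sub′ : ∀ {y} → y ∈ xs → y ∈ as ++ bs
    sub′ y∈ with ∈-resp-↭ (shift x as bs) (sub (there y∈))
    ... | here refl = ⊥-elim (All.lookup x∉ y∈ refl)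
    ... | there y∈′ = y∈′

  module _ {R : Rel A 0ℓ} where

    Linked-++⁻ʳ : ∀ xs {ys} → Linked R (xs ++ ys) → Linked R ys
    Linked-++⁻ʳ []       l = l
    Linked-++⁻ʳ (x ∷ xs) l = Linked-++⁻ʳ xs (Linked.tail l)

    Linked-prefix : ∀ xs {x ys} → Linked R (xs ++ x ∷ ys) → Linked R (xs ++ x ∷ [])
    Linked-prefix []           l       = [-]
    Linked-prefix (_ ∷ [])     (r ∷ l) = r ∷ [-]
    Linked-prefix (_ ∷ z ∷ xs) (r ∷ l) = r ∷ Linked-prefix (z ∷ xs) l

    Linked-glue : ∀ xs {x ys} → Linked R (xs ++ x ∷ []) → Linked R (x ∷ ys) → Linked R (xs ++ x ∷ ys)
    Linked-glue []           _       m = m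
    Linked-glue (_ ∷ [])     (r ∷ _) m = r ∷ m
    Linked-glue (_ ∷ z ∷ xs) (r ∷ l) m = r ∷ Linked-glue (z ∷ xs) l m

    Linked-++⁻ˡ : ∀ xs {ys} → Linked R (xs ++ ys) → Linked R xs
    Linked-++⁻ˡ []           l       = []
    Linked-++⁻ˡ (x ∷ [])     l       = [-]
    Linked-++⁻ˡ (x ∷ z ∷ xs) (r ∷ l) = r ∷ Linked-++⁻ˡ (z ∷ xs) l

    Linked-∷ʳ : ∀ xs {x y} → Linked R (xs ++ x ∷ []) → R x y → Linked R ((xs ++ x ∷ []) ++ y ∷ [])
    Linked-∷ʳ xs {x} {y} l r = subst (Linked R) (sym (++-assoc xs (x ∷ []) (y ∷ []))) (Linked-glue xs l (r ∷ [-]))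

    -- A closed walk from `x` through `xs` back to `x`; that its vertices are distinct is stated
    -- separately.
    Cycle : A → List A → Set
    Cycle x xs = Linked R (x ∷ xs ++ x ∷ [])

    Cycle⇒Linked : ∀ {x xs} → Cycle x xs → Linked R (x ∷ xs)
    Cycle⇒Linked {x} {xs} cyc = Linked-++⁻ˡ (x ∷ xs) cyc

    rotate-at : ∀ {c cs} as {x bs} → c ∷ cs ≡ as ++ x ∷ bs → Cycle c cs → Cycle x (bs ++ as)
    rotate-at [] {x} {bs} refl cyc rewrite ++-identityʳ bs = cyc
    rotate-at (c ∷ as) {x} {bs} refl cyc =
      subst (Linked R) (cong (x ∷_) (sym (++-assoc bs (c ∷ as) (x ∷ []))))
        (Linked-glue (x ∷ bs) (Linked-++⁻ʳ (c ∷ as) cyc′) (Linked-prefix (c ∷ as) cyc′))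
      where
      cyc′ : Linked R (c ∷ as ++ x ∷ bs ++ c ∷ [])
      cyc′ = subst (Linked R) (cong (c ∷_) (++-assoc as (x ∷ bs) (c ∷ []))) cyc

    rotate : ∀ {c cs x} → Cycle c cs → x ∈ c ∷ cs → ∃ λ ds → Cycle x ds × x ∷ ds ↭ c ∷ cs
    rotate cyc x∈ with ∈-∃++ x∈
    ... | as , bs , eq = bs ++ as , rotate-at as eq cyc , ↭-trans (++-comm (_ ∷ bs) as) (↭-reflexive (sym eq))

  ∷ʳ-suffix : ∀ (xs ws : List A) {e c cs} → xs ++ e ∷ [] ≡ ws ++ c ∷ cs → ∃ λ ys → c ∷ cs ≡ ys ++ e ∷ []
  ∷ʳ-suffix xs        []       eq = xs , sym eq
  ∷ʳ-suffix []        (w ∷ []) ()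
  ∷ʳ-suffix []        (w ∷ _ ∷ ws) ()
  ∷ʳ-suffix (x ∷ xs)  (w ∷ ws) eq = ∷ʳ-suffix xs ws (proj₂ (∷-injective eq))

  module _ (t : A → Bool) where

    -- The entries of p ∷ ys that are followed by an entry satisfying t, and those followed by one that
    -- does not.  For p the last entry of ys these are the cyclic predecessors.
    selectPred rejectPred : A → List A → List A
    selectPred p []       = []
    selectPred p (y ∷ ys) = if t y then p ∷ selectPred y ys else selectPred y ys
    rejectPred p []       = []
    rejectPred p (y ∷ ys) = if t y then rejectPred y ys else p ∷ rejectPred y ys

    lastOf : A → List A → A
    lastOf p []       = p
    lastOf p (y ∷ ys) = lastOf y ys

    lastOf-∷ʳ : ∀ p ys e → lastOf p (ys ++ e ∷ []) ≡ e
    lastOf-∷ʳ p []       e = refl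
    lastOf-∷ʳ p (y ∷ ys) e = lastOf-∷ʳ y ys e

    select-reject-↭ : ∀ p ys → selectPred p ys ++ rejectPred p ys ++ lastOf p ys ∷ [] ↭ p ∷ ys
    select-reject-↭ p []       = ↭-refl
    select-reject-↭ p (y ∷ ys) with t y
    ... | true  = prep p (select-reject-↭ y ys)
    ... | false = ↭-trans (shift p (selectPred y ys) _) (prep p (select-reject-↭ y ys))

    -- Starting from the last entry `e` puts `e` twice into `select-reject-↭`, as predecessor of the
    -- first entry and as leftover last entry; one copy is cancelled.
    cyclic-select-reject-↭ : ∀ ys e → selectPred e (ys ++ e ∷ []) ++ rejectPred e (ys ++ e ∷ []) ↭ ys ++ e ∷ []
    cyclic-select-reject-↭ ys e = drop-∷ (↭-trans (++-comm (e ∷ []) _)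
      (↭-trans (↭-reflexive (trans (++-assoc (selectPred e zs) _ _)
                  (cong (λ l → selectPred e zs ++ rejectPred e zs ++ l ∷ []) (sym (lastOf-∷ʳ e ys e)))))
               (select-reject-↭ e zs)))
      where zs = ys ++ e ∷ []

    length-selectPred : ∀ p ys → length (selectPred p ys) ≡ length (filterᵇ t ys)
    length-selectPred p []       = refl
    length-selectPred p (y ∷ ys) with t y
    ... | true  = cong suc (length-selectPred y ys)
    ... | false = length-selectPred y ys

    ∈-selectPred⁻ : ∀ p ys {x} → x ∈ selectPred p ys →
      ∃ λ as → ∃ λ y → ∃ λ bs → ys ≡ as ++ y ∷ bs × t y ≡ true × (∃ λ zs → p ∷ as ≡ zs ++ x ∷ [])
    ∈-selectPred⁻ p (y ∷ ys) x∈ with t y in ty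
    ∈-selectPred⁻ p (y ∷ ys) (here refl) | true = [] , y , ys , refl , ty , [] , refl
    ∈-selectPred⁻ p (y ∷ ys) (there x∈) | true with ∈-selectPred⁻ y ys x∈
    ... | as , v , bs , refl , tv , zs , eq = y ∷ as , v , bs , refl , tv , p ∷ zs , cong (p ∷_) eq
    ∈-selectPred⁻ p (y ∷ ys) x∈ | false with ∈-selectPred⁻ y ys x∈
    ... | as , v , bs , refl , tv , zs , eq = y ∷ as , v , bs , refl , tv , p ∷ zs , cong (p ∷_) eq

  -- Long paths

  -- Here α = |A|, s is the number of other vertices of C, t = |W| - 1, and d is the out-degree
  -- within A of a vertex of A. If α ≤ δ, the two degree bounds are added and qd ≤ pα ≤ pδ. If δ ≤
  -- α, then t is discarded and (q - p)δ ≤ (q - p)α is used.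
  lasso-arithmetic : ∀ p q δ t α s d → p ≤ q → q * d ≤ p * α → δ ≤ d + s → δ ≤ t + α →
    2 * q * δ ≤ q * (t + (α + s)) + p * δ
  lasso-arithmetic p q δ t α s d p≤q few δ≤d+s δ≤t+α with ≤-total α δ
  ... | inj₁ α≤δ = begin
    2 * q * δ                           ≡⟨ double q δ ⟩
    q * δ + q * δ                       ≤⟨ +-mono-≤ (*-monoʳ-≤ q δ≤t+α) (*-monoʳ-≤ q δ≤d+s) ⟩
    q * (t + α) + q * (d + s)           ≡⟨ cong (q * (t + α) +_) (*-distribˡ-+ q d s) ⟩
    q * (t + α) + (q * d + q * s)       ≤⟨ +-monoʳ-≤ (q * (t + α)) (+-monoˡ-≤ (q * s) (≤-trans few (*-monoʳ-≤ p α≤δ))) ⟩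
    q * (t + α) + (p * δ + q * s)       ≡⟨ rearrange p q δ t α s ⟩
    q * (t + (α + s)) + p * δ           ∎
    where
    open ≤-Reasoning
    double : ∀ q δ → 2 * q * δ ≡ q * δ + q * δ
    double = solve-∀
    rearrange : ∀ p q δ t α s → q * (t + α) + (p * δ + q * s) ≡ q * (t + (α + s)) + p * δ
    rearrange = solve-∀
  ... | inj₂ δ≤α = begin
    2 * q * δ                           ≡⟨ double q δ ⟩
    q * δ + q * δ                       ≤⟨ +-monoʳ-≤ (q * δ) (*-monoʳ-≤ q δ≤d+s) ⟩
    q * δ + q * (d + s)                 ≡⟨ cong (q * δ +_) (*-distribˡ-+ q d s) ⟩
    q * δ + (q * d + q * s)             ≤⟨ +-monoʳ-≤ (q * δ) (+-monoˡ-≤ (q * s) few) ⟩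
    q * δ + (p * α + q * s)             ≡⟨ cong (λ r → r * δ + (p * α + q * s)) (m∸n+n≡m p≤q) ⟨
    (r + p) * δ + (p * α + q * s)       ≡⟨ rearrange₁ p r δ α (q * s) ⟩
    r * δ + (p * α + q * s + p * δ)     ≤⟨ +-monoˡ-≤ _ (*-monoʳ-≤ r δ≤α) ⟩
    r * α + (p * α + q * s + p * δ)     ≡⟨ rearrange₂ p r δ α (q * s) ⟩
    (r + p) * α + q * s + p * δ         ≡⟨ cong (λ r → r * α + q * s + p * δ) (m∸n+n≡m p≤q) ⟩
    q * α + q * s + p * δ               ≤⟨ m≤n+m _ (q * t) ⟩
    q * t + (q * α + q * s + p * δ)     ≡⟨ rearrange₃ p q δ t α s ⟩
    q * (t + (α + s)) + p * δ           ∎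
    where
    open ≤-Reasoning
    r = q ∸ p
    double : ∀ q δ → 2 * q * δ ≡ q * δ + q * δ
    double = solve-∀
    rearrange₁ : ∀ p r δ α z → (r + p) * δ + (p * α + z) ≡ r * δ + (p * α + z + p * δ)
    rearrange₁ = solve-∀
    rearrange₂ : ∀ p r δ α z → r * α + (p * α + z + p * δ) ≡ (r + p) * α + z + p * δ
    rearrange₂ = solve-∀
    rearrange₃ : ∀ p q δ t α s → q * t + (q * α + q * s + p * δ) ≡ q * (t + (α + s)) + p * δ
    rearrange₃ = solve-∀

  module LongPath {V : Set} (_≟_ : DecidableEquality V) (_⇒_ : V → V → Bool) (no-loop : ∀ v → v ⇒ v ≡ false)
    (N : V → List V) (N-unique : ∀ v → Unique (N v)) (N-sound : ∀ {v u} → u ∈ N v → v ⇒ u ≡ true)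
    (δ : ℕ) (δ>0 : 0 < δ) (δ≤N : ∀ v → δ ≤ length (N v))
    (p q : ℕ) (p≤q : p ≤ q)
    (sparse : ∀ x L → ∃ λ z → z ∈ x ∷ L × q * length (filterᵇ (z ⇒_) (x ∷ L)) ≤ p * length (x ∷ L))
    (half : ∀ x L → ∃ λ z → z ∈ x ∷ L × 2 * length (filterᵇ (z ⇒_) (x ∷ L)) < length (x ∷ L)) where

    open DecMembership _≟_ using (_∈?_)

    _⟶_ : V → V → Set
    x ⟶ y = x ⇒ y ≡ true

    Chain : List V → Set
    Chain = Linked _⟶_

    -- The path has `length vs` arcs, and the inequality says that this is at least (2 - p / q)δ.
    LongPath : Set
    LongPath = ∃ λ v → ∃ λ vs → Chain (v ∷ vs) × Unique (v ∷ vs) × 2 * q * δ ≤ q * length vs + p * δ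

    ∉N : ∀ v → v ∉ N v
    ∉N v v∈ with () ← trans (sym (N-sound v∈)) (no-loop v)

    δ<-⊇N : ∀ {e xs} → e ∈ xs → (∀ {x} → x ∈ N e → x ∈ xs) → δ < length xs
    δ<-⊇N {e} e∈ sub = ≤-trans (s≤s (δ≤N e))
      (Unique-⊆⇒length≤ (∉⇒Unique-∷ (∉N e) (N-unique e)) λ { (here refl) → e∈ ; (there x∈) → sub x∈ })

    N≤count : ∀ {v xs} → (∀ {x} → x ∈ N v → x ∈ xs) → length (N v) ≤ length (filterᵇ (v ⇒_) xs)
    N≤count {v} {xs} sub = Unique-⊆⇒length≤ (N-unique v) (λ x∈ → ∈-filterᵇ⁺ (v ⇒_) xs (sub x∈) (N-sound x∈))

    long⇒LongPath : ∀ xs → Chain xs → Unique xs → suc (2 * δ) ≤ length xs → LongPath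
    long⇒LongPath (v ∷ vs) chain uniq (s≤s le) = v , vs , chain , uniq , (begin
      2 * q * δ              ≡⟨ lemma q δ ⟩
      q * (2 * δ)            ≤⟨ *-monoʳ-≤ q le ⟩
      q * length vs          ≤⟨ m≤m+n _ _ ⟩
      q * length vs + p * δ  ∎)
      where
      open ≤-Reasoning
      lemma : ∀ q δ → 2 * q * δ ≡ q * (2 * δ)
      lemma = solve-∀

    big+big : ∀ {m n} → δ < m → δ < n → suc (2 * δ) ≤ m + n
    big+big {m} {n} δ<m δ<n = begin
      suc (δ + (δ + 0)) ≡⟨ cong (λ k → suc (δ + k)) (+-identityʳ δ) ⟩
      suc δ + δ         ≤⟨ +-mono-≤ δ<m (<⇒≤ δ<n) ⟩
      m + n             ∎
      where open ≤-Reasoning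

    -- The earliest out-neighbour of `e` on the path closes a cycle that contains `e` and all its
    -- out-neighbours, hence more than δ vertices.
    closeEnd : ∀ xs e → Chain (xs ++ e ∷ []) → (∀ {x} → x ∈ N e → x ∈ xs ++ e ∷ []) →
      ∃ λ W → ∃ λ c → ∃ λ cs → xs ++ e ∷ [] ≡ W ++ c ∷ cs × Cycle {R = _⟶_} c cs × δ < length (c ∷ cs)
    closeEnd xs e chain sub with searchFirst (_∈? N e) (xs ++ e ∷ [])
    ... | inj₂ none = ⊥-elim (absurd (N e) (≤-trans δ>0 (δ≤N e)) (λ x∈ → none (sub x∈) x∈))
      where
      absurd : ∀ (L : List V) → 0 < length L → (∀ {x} → x ∈ L → ⊥) → ⊥
      absurd (x ∷ _) _ empty = empty (here refl)
    ... | inj₁ (W , c , cs , eq , c∈ , none) with ∷ʳ-suffix xs W eq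
    ...   | ys , eq′ = W , c , cs , eq , cyc , δ<-⊇N e∈ sub′
      where
      cyc : Chain (c ∷ cs ++ c ∷ [])
      cyc = subst (λ zs → Chain (zs ++ c ∷ [])) (sym eq′)
        (Linked-∷ʳ ys (subst Chain eq′ (Linked-++⁻ʳ W (subst Chain eq chain))) (N-sound c∈))
      e∈ : e ∈ c ∷ cs
      e∈ = subst (e ∈_) (sym eq′) (∈-++⁺ʳ ys (here refl))
      sub′ : ∀ {x} → x ∈ N e → x ∈ c ∷ cs
      sub′ x∈ with ∈-++⁻ W (subst (_ ∈_) eq (sub x∈))
      ... | inj₁ x∈W = ⊥-elim (none x∈W x∈)
      ... | inj₂ x∈C = x∈C

    -- Lassos in a set closed under out-neighbours

    module _ (U : List V) (closed : ∀ {x y} → x ∈ U → y ∈ N x → y ∈ U) where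

      record Lasso : Set where
        constructor mkLasso
        field
          W     : List V
          c     : V
          cs    : List V
          entry : Chain (W ++ c ∷ [])
          cycle : Cycle {R = _⟶_} c cs
          uniq  : Unique (W ++ c ∷ cs)
          sub   : ∀ {x} → x ∈ W ++ c ∷ cs → x ∈ U
          big   : δ < length (c ∷ cs)

        total : ℕ
        total = length (W ++ c ∷ cs)

        chain : Chain (W ++ c ∷ cs)
        chain = Linked-glue W entry (Cycle⇒Linked cycle)

      open Lasso

      PathIn : ℕ → Set
      PathIn n = ∃ λ zs → Chain zs × Unique zs × (∀ {x} → x ∈ zs → x ∈ U) × n < length zs

      ClosedSubset : Set
      ClosedSubset = ∃ λ U′ → (∀ {x y} → x ∈ U′ → y ∈ N x → y ∈ U′) × length U′ < length U × ∃ (_∈ U′)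

      -- The path is extended until all out-neighbours of its last vertex lie on it, and then
      -- closed. It stays inside `U`, so `f` bounds the number of extensions.
      close : ∀ f n ((zs , _) : PathIn n) → length U < length zs + f → Σ Lasso λ l → n < total l
      close zero n (zs , _ , uniq , sub , _) fuel =
        ⊥-elim (<⇒≱ fuel (subst (_≤ length U) (sym (+-identityʳ _)) (Unique-⊆⇒length≤ uniq sub)))
      close (suc f) n (zs , chain , uniq , sub , n<) fuel with initLast zs
      ... | [] with () ← n<
      ... | xs ∷ʳ′ e with search (λ x → ¬? (x ∈? (xs ++ e ∷ []))) (N e)
      ...   | inj₁ (y , y∈N , y∉) = close f n
              ( (xs ++ e ∷ []) ++ y ∷ [] , Linked-∷ʳ xs chain (N-sound y∈N) , Unique-∷ʳ y∉ uniq
              , sub′ , <-≤-trans n< (subst (length (xs ++ e ∷ []) ≤_) (sym len) (n≤1+n _)))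
              (subst (length U <_) (trans (+-suc _ f) (cong (_+ f) (sym len))) fuel)
        where
        len : length ((xs ++ e ∷ []) ++ y ∷ []) ≡ suc (length (xs ++ e ∷ []))
        len = trans (length-++ (xs ++ e ∷ [])) (+-comm _ 1)
        sub′ : ∀ {x} → x ∈ (xs ++ e ∷ []) ++ y ∷ [] → x ∈ U
        sub′ x∈ with ∈-++⁻ (xs ++ e ∷ []) x∈
        ... | inj₁ x∈′ = sub x∈′
        ... | inj₂ (here refl) = closed (sub (∈-++⁺ʳ xs (here refl))) y∈N
      ...   | inj₂ none with closeEnd xs e chain (λ {x} x∈ → inside x x∈)
        where
        inside : ∀ x → x ∈ N e → x ∈ xs ++ e ∷ []
        inside x x∈ with x ∈? (xs ++ e ∷ [])
        ... | yes x∈′ = x∈′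
        ... | no  x∉  = ⊥-elim (none x∈ x∉)
      ...     | W , c , cs , eq , cyc , big =
        mkLasso W c cs (Linked-prefix W (subst Chain eq chain)) cyc (subst Unique eq uniq)
          (λ x∈ → sub (subst (_ ∈_) (sym eq) x∈)) big
        , subst (λ zs → n < length zs) eq n<

      -- Z collects the vertices that reach C, each with a path that runs around C at its end.  If the
      -- cycle K never meets Z, then the complement of Z is closed under out-neighbours.
      connect : ∀ {k ks c cs} → Cycle {R = _⟶_} k ks → Cycle {R = _⟶_} c cs →
        Unique (k ∷ ks) → Unique (c ∷ cs) → (∀ {x} → x ∈ k ∷ ks → x ∉ c ∷ cs) →
        (∀ {x} → x ∈ k ∷ ks → x ∈ U) → (∀ {x} → x ∈ c ∷ cs → x ∈ U) →
        δ < length (k ∷ ks) → δ < length (c ∷ cs) → LongPath ⊎ ClosedSubset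
      connect {k} {ks} {c} {cs} cycK cycC uniqK uniqC disjoint subK subC bigK bigC =
        grow (length U) (c ∷ cs) uniqC subC (here refl) tails disjoint (m<n+m (length U) (s≤s z≤n))
        where
        Tail : List V → V → Set
        Tail Z z = ∃ λ T → Chain (z ∷ T) × Unique (z ∷ T) × (∀ {x} → x ∈ z ∷ T → x ∈ Z) × δ < length (z ∷ T)
        tails : ∀ {z} → z ∈ c ∷ cs → Tail (c ∷ cs) z
        tails z∈ with rotate cycC z∈
        ... | ds , cyc , perm = ds , Cycle⇒Linked cyc , Unique-resp-↭ (↭-sym perm) uniqC
                              , ∈-resp-↭ perm , subst (δ <_) (sym (↭-length perm)) bigC
        grow : ∀ f Z → Unique Z → (∀ {x} → x ∈ Z → x ∈ U) → c ∈ Z → (∀ {z} → z ∈ Z → Tail Z z) →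
          (∀ {x} → x ∈ k ∷ ks → x ∉ Z) → length U < length Z + f → LongPath ⊎ ClosedSubset
        grow zero Z uniqZ subZ _ _ _ fuel =
          ⊥-elim (<⇒≱ fuel (subst (_≤ length U) (sym (+-identityʳ _)) (Unique-⊆⇒length≤ uniqZ subZ)))
        grow (suc f) Z uniqZ subZ c∈Z tail K∉Z fuel
          with search (λ v → entering v) U
          where
          entering : ∀ v → Dec (v ∉ Z × ∃ λ z → z ∈ N v × z ∈ Z)
          entering v with v ∈? Z | search (_∈? Z) (N v)
          ... | yes v∈ | _ = no λ (v∉ , _) → v∉ v∈
          ... | no v∉ | inj₁ found = yes (v∉ , found)
          ... | no v∉ | inj₂ none = no λ (_ , _ , z∈N , z∈Z) → none z∈N z∈Z
        ... | inj₂ none = inj₂ (filter (λ x → ¬? (x ∈? Z)) U , closed′ , shorter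
                , k , ∈-filter⁺ (λ x → ¬? (x ∈? Z)) (subK (here refl)) (K∉Z (here refl)))
          where
          closed′ : ∀ {x y} → x ∈ filter (λ x → ¬? (x ∈? Z)) U → y ∈ N x → y ∈ filter (λ x → ¬? (x ∈? Z)) U
          closed′ {x} {y} x∈ y∈N with ∈-filter⁻ (λ x → ¬? (x ∈? Z)) {xs = U} x∈
          ... | x∈U , x∉Z = ∈-filter⁺ (λ x → ¬? (x ∈? Z)) (closed x∈U y∈N)
                              (λ y∈Z → none x∈U (x∉Z , y , y∈N , y∈Z))
          shorter : length (filter (λ x → ¬? (x ∈? Z)) U) < length U
          shorter = filter-notAll (λ x → ¬? (x ∈? Z)) U (Any.map (λ { refl c∉Z → c∉Z c∈Z }) (subZ c∈Z))
        ... | inj₁ (v , v∈U , v∉Z , z , z∈N , z∈Z) with v ∈? (k ∷ ks) | tail z∈Z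
        -- Outside K, the vertex `v` joins Z; its tail is `v` followed by the tail of `z`.
        ...   | no v∉K | T , chT , uT , subT , bigT =
          grow f (v ∷ Z) (∉⇒Unique-∷ v∉Z uniqZ) (λ { (here refl) → v∈U ; (there x∈) → subZ x∈ }) (there c∈Z)
            (λ { (here refl) → z ∷ T , N-sound z∈N ∷ chT , ∉⇒Unique-∷ (λ v∈ → v∉Z (subT v∈)) uT
                             , (λ { (here refl) → here refl ; (there x∈) → there (subT x∈) }) , m<n⇒m<1+n bigT
               ; (there y∈) → let T , chT , uT , subT , bigT = tail y∈ in T , chT , uT , (λ x∈ → there (subT x∈)) , bigT })
            (λ { x∈ (here refl) → v∉K x∈ ; x∈ (there x∈Z) → K∉Z x∈ x∈Z })
            (subst (length U <_) (+-suc (length Z) f) fuel)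
        -- Running around K to end at `v`, stepping to `z` and following its tail gives two disjoint
        -- stretches of more than δ vertices each.
        ...   | yes v∈K | T , chT , uT , subT , bigT with rotate cycK v∈K
        ...     | ds , cyc , perm = inj₁ (long⇒LongPath ((ds ++ v ∷ []) ++ z ∷ T) chain′ uniq′
                    (subst (suc (2 * δ) ≤_) (sym (length-++ (ds ++ v ∷ []))) (big+big bigD bigT)))
          where
          perm′ : ds ++ v ∷ [] ↭ k ∷ ks
          perm′ = ↭-trans (++-comm ds (v ∷ [])) perm
          chain′ : Chain ((ds ++ v ∷ []) ++ z ∷ T)
          chain′ = Linked-glue (ds ++ v ∷ []) (Linked-∷ʳ ds (Linked.tail cyc) (N-sound z∈N)) chT
          uniq′ : Unique ((ds ++ v ∷ []) ++ z ∷ T)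
          uniq′ = Unique.++⁺ (Unique-resp-↭ (↭-sym perm′) uniqK) uT
            (λ (x∈D , x∈T) → K∉Z (∈-resp-↭ perm′ x∈D) (subT x∈T))
          bigD : δ < length (ds ++ v ∷ [])
          bigD = subst (δ <_) (sym (↭-length perm′)) bigK

      BiggerCycle : Lasso → Set
      BiggerCycle l = Σ Lasso λ l′ → total l ≡ total l′ × length (c l ∷ cs l) < length (c l′ ∷ cs l′)

      -- The last two alternatives improve the pair (number of vertices, length of the cycle)
      -- lexicographically.
      Progress : Lasso → Set
      Progress l = (LongPath ⊎ ClosedSubset) ⊎ PathIn (total l) ⊎ BiggerCycle l

      -- An arc that leaves the cycle extends a path around it. If there is none, a vertex with
      -- fewer than |C|/2 out-neighbours in C has all its out-neighbours there, so |C| > 2δ.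
      stepCycle : ∀ (l : Lasso) → W l ≡ [] → Progress l
      stepCycle (mkLasso .[] c cs _ cyc uniq sub big) refl
        with search (λ x → escapes x) (c ∷ cs)
        where
        escapes : ∀ x → Dec (∃ λ y → y ∈ N x × y ∉ c ∷ cs)
        escapes x with search (λ y → ¬? (y ∈? (c ∷ cs))) (N x)
        ... | inj₁ found = yes found
        ... | inj₂ none  = no λ (_ , y∈ , y∉) → none y∈ y∉
      ... | inj₁ (x , x∈ , y , y∈N , y∉) with rotate cyc x∈
      ...   | ds , cyc′ , perm = inj₂ (inj₁
            ( (ds ++ x ∷ []) ++ y ∷ [] , Linked-∷ʳ ds (Linked.tail cyc′) (N-sound y∈N)
            , Unique-∷ʳ (λ y∈D → y∉ (∈-resp-↭ perm′ y∈D)) (Unique-resp-↭ (↭-sym perm′) uniq)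
            , sub′
            , subst₂ _<_ (↭-length perm′) (sym (trans (length-++ (ds ++ x ∷ [])) (+-comm _ 1))) ≤-refl))
        where
        perm′ : ds ++ x ∷ [] ↭ c ∷ cs
        perm′ = ↭-trans (++-comm ds (x ∷ [])) perm
        sub′ : ∀ {z} → z ∈ (ds ++ x ∷ []) ++ y ∷ [] → z ∈ U
        sub′ z∈ with ∈-++⁻ (ds ++ x ∷ []) z∈
        ... | inj₁ z∈D = sub (∈-resp-↭ perm′ z∈D)
        ... | inj₂ (here refl) = closed (sub x∈) y∈N
      stepCycle (mkLasso .[] c cs _ cyc uniq sub big) refl | inj₂ none with half c cs
      ... | x , x∈ , 2deg< = inj₁ (inj₁ (long⇒LongPath (c ∷ cs) (Cycle⇒Linked cyc) uniq
            (≤-<-trans (*-monoʳ-≤ 2 (≤-trans (δ≤N x) (N≤count inside))) 2deg<)))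
        where
        inside : ∀ {y} → y ∈ N x → y ∈ c ∷ cs
        inside {y} y∈ with y ∈? (c ∷ cs)
        ... | yes y∈C = y∈C
        ... | no y∉C  = ⊥-elim (none x∈ (y , y∈ , y∉C))

      -- The step for a lasso with a nonempty path before its cycle

      module _ (W₀ : List V) (w c : V) (cs : List V)
        (entry : Chain ((W₀ ++ w ∷ []) ++ c ∷ [])) (cyc : Cycle {R = _⟶_} c cs)
        (uniq : Unique ((W₀ ++ w ∷ []) ++ c ∷ cs)) (sub : ∀ {x} → x ∈ (W₀ ++ w ∷ []) ++ c ∷ cs → x ∈ U)
        (big : δ < length (c ∷ cs)) where

        private
          Wʷ C : List V
          Wʷ = W₀ ++ w ∷ []
          C = c ∷ cs
          lasso : Lasso
          lasso = mkLasso Wʷ c cs entry cyc uniq sub big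
          chainW : Chain Wʷ
          chainW = Linked-++⁻ˡ Wʷ entry

        -- A maximal path Y from an out-neighbour of w in the complement of W.  It cannot meet C, since
        -- W, Y and C would form a longer path.  If its last vertex has an out-neighbour in W, with a part
        -- W₁ of W before it, then Y followed by the rest of W and C is too long unless |Y| ≤ |W₁|, and then
        -- |W| > δ.  Otherwise Y ends in a cycle with more than δ vertices.
        branch : ∀ f ys e → Chain (Wʷ ++ ys ++ e ∷ []) → Unique ((Wʷ ++ C) ++ ys ++ e ∷ []) →
          (∀ {x} → x ∈ ys ++ e ∷ [] → x ∈ U) →
          length U < length ((Wʷ ++ C) ++ ys ++ e ∷ []) + f → Progress lasso
        branch zero ys e chainY uniqY subY fuel =
          ⊥-elim (<⇒≱ fuel (subst (_≤ length U) (sym (+-identityʳ _)) (Unique-⊆⇒length≤ uniqY sub′)))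
          where
          sub′ : ∀ {x} → x ∈ (Wʷ ++ C) ++ ys ++ e ∷ [] → x ∈ U
          sub′ x∈ with ∈-++⁻ (Wʷ ++ C) x∈
          ... | inj₁ x∈P = sub x∈P
          ... | inj₂ x∈Y = subY x∈Y
        branch (suc f) ys e chainY uniqY subY fuel with search (λ z → ¬? (z ∈? (Wʷ ++ Y))) (N e)
          where Y = ys ++ e ∷ []
        ... | inj₁ (z , z∈N , z∉WY) = continue (z ∈? C)
          where
          Y = ys ++ e ∷ []
          chainZ : Chain ((Wʷ ++ Y) ++ z ∷ [])
          chainZ = subst (λ l → Chain (l ++ z ∷ [])) (++-assoc Wʷ ys (e ∷ []))
            (Linked-∷ʳ (Wʷ ++ ys) (subst Chain (sym (++-assoc Wʷ ys (e ∷ []))) chainY) (N-sound z∈N))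
          continue : Dec (z ∈ C) → Progress lasso
          continue (yes z∈C) with rotate cyc z∈C
          ... | ds , cyc′ , perm = inj₂ (inj₁
                ( (Wʷ ++ Y) ++ z ∷ ds
                , Linked-glue (Wʷ ++ Y) chainZ (Cycle⇒Linked cyc′)
                , Unique-resp-↭ perm′ uniqY
                , sub′
                , subst (length (Wʷ ++ C) <_) (trans (sym (length-++ (Wʷ ++ C))) (↭-length perm′))
                    (m<m+n _ (subst (0 <_) (sym (trans (length-++ ys) (+-comm _ 1))) (s≤s z≤n)))))
            where
            perm′ : (Wʷ ++ C) ++ Y ↭ (Wʷ ++ Y) ++ z ∷ ds
            perm′ = ↭-trans (↭-reflexive (++-assoc Wʷ C Y))
              (↭-trans (++⁺ˡ Wʷ (↭-trans (++-comm C Y) (++⁺ˡ Y (↭-sym perm)))) (↭-reflexive (sym (++-assoc Wʷ Y (z ∷ ds)))))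
            sub′ : ∀ {x} → x ∈ (Wʷ ++ Y) ++ z ∷ ds → x ∈ U
            sub′ x∈ with ∈-++⁻ (Wʷ ++ C) (∈-resp-↭ (↭-sym perm′) x∈)
            ... | inj₁ x∈P = sub x∈P
            ... | inj₂ x∈Y = subY x∈Y
          continue (no z∉C) = branch f (ys ++ e ∷ []) z
            (subst Chain (++-assoc Wʷ Y (z ∷ [])) chainZ)
            (subst Unique (++-assoc (Wʷ ++ C) Y (z ∷ [])) (Unique-∷ʳ z∉ uniqY))
            (λ x∈ → sub′ (∈-++⁻ Y x∈))
            (subst (length U <_) (trans (+-suc _ f) (cong (_+ f) (sym len))) fuel)
            where
            z∉ : z ∉ (Wʷ ++ C) ++ Y
            z∉ z∈ with ∈-++⁻ (Wʷ ++ C) z∈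
            ... | inj₂ z∈Y = z∉WY (∈-++⁺ʳ Wʷ z∈Y)
            ... | inj₁ z∈P with ∈-++⁻ Wʷ z∈P
            ...   | inj₁ z∈W = z∉WY (∈-++⁺ˡ z∈W)
            ...   | inj₂ z∈C = z∉C z∈C
            sub′ : ∀ {x} → x ∈ Y ⊎ x ∈ z ∷ [] → x ∈ U
            sub′ (inj₁ x∈) = subY x∈
            sub′ (inj₂ (here refl)) = closed (subY (∈-++⁺ʳ ys (here refl))) z∈N
            len : length ((Wʷ ++ C) ++ Y ++ z ∷ []) ≡ suc (length ((Wʷ ++ C) ++ Y))
            len = trans (cong length (sym (++-assoc (Wʷ ++ C) Y (z ∷ [])))) (trans (length-++ ((Wʷ ++ C) ++ Y)) (+-comm _ 1))
        ... | inj₂ none = finish (searchFirst (_∈? N e) Wʷ)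
          where
          Y = ys ++ e ∷ []
          N⊆WY : ∀ {z} → z ∈ N e → z ∈ Wʷ ⊎ z ∈ Y
          N⊆WY {z} z∈ with z ∈? (Wʷ ++ Y)
          ... | yes z∈′ = ∈-++⁻ Wʷ z∈′
          ... | no  z∉  = ⊥-elim (none z∈ z∉)
          uniq-Y : Unique Y
          uniq-Y = Unique-++⁻ʳ (Wʷ ++ C) uniqY
          finish : _ → Progress lasso
          finish (inj₂ noW) with closeEnd ys e (Linked-++⁻ʳ Wʷ chainY) (λ z∈ → inY z∈ (N⊆WY z∈))
            where
            inY : ∀ {z} → z ∈ N e → z ∈ Wʷ ⊎ z ∈ Y → z ∈ Y
            inY z∈ (inj₁ z∈W) = ⊥-elim (noW z∈W z∈)
            inY z∈ (inj₂ z∈Y) = z∈Y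
          ... | ks₀ , k , ks , eq , cycK , bigK = inj₁ (connect cycK cyc
                (Unique-++⁻ʳ ks₀ (subst Unique eq uniq-Y)) (Unique-++⁻ʳ Wʷ uniq)
                (λ x∈K x∈C → Unique-disjoint (Wʷ ++ C) uniqY (∈-++⁺ʳ Wʷ x∈C) (inY′ x∈K))
                (λ x∈K → subY (inY′ x∈K)) (λ x∈C → sub (∈-++⁺ʳ Wʷ x∈C)) bigK big)
            where
            inY′ : ∀ {x} → x ∈ k ∷ ks → x ∈ Y
            inY′ x∈ = subst (_ ∈_) (sym eq) (∈-++⁺ʳ ks₀ x∈)
          finish (inj₁ (W₁ , v , W₂ , eq , v∈N , none₁)) with length W₁ <? length Y
          ... | yes short = inj₂ (inj₁ (Y ++ (v ∷ W₂) ++ C , chain′ , uniq′ , sub′ , longer))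
            where
            chainWC : Chain (W₁ ++ v ∷ (W₂ ++ C))
            chainWC = subst Chain (trans (cong (_++ C) eq) (++-assoc W₁ (v ∷ W₂) C)) (Linked-glue Wʷ entry (Cycle⇒Linked cyc))
            chain′ : Chain (Y ++ v ∷ (W₂ ++ C))
            chain′ = Linked-glue Y (Linked-∷ʳ ys (Linked-++⁻ʳ Wʷ chainY) (N-sound v∈N)) (Linked-++⁻ʳ W₁ chainWC)
            perm : (Wʷ ++ C) ++ Y ↭ W₁ ++ Y ++ (v ∷ W₂) ++ C
            perm = ↭-trans (↭-reflexive (cong (λ l → (l ++ C) ++ Y) eq))
              (↭-trans (++⁺ʳ Y (↭-reflexive (++-assoc W₁ (v ∷ W₂) C)))
              (↭-trans (↭-reflexive (++-assoc W₁ ((v ∷ W₂) ++ C) Y)) (++⁺ˡ W₁ (++-comm ((v ∷ W₂) ++ C) Y))))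
            uniq′ : Unique (Y ++ (v ∷ W₂) ++ C)
            uniq′ = Unique-++⁻ʳ W₁ (Unique-resp-↭ perm uniqY)
            sub′ : ∀ {x} → x ∈ Y ++ (v ∷ W₂) ++ C → x ∈ U
            sub′ x∈ with ∈-++⁻ (Wʷ ++ C) (∈-resp-↭ (↭-sym perm) (∈-++⁺ʳ W₁ x∈))
            ... | inj₁ x∈P = sub x∈P
            ... | inj₂ x∈Y = subY x∈Y
            longer : length (Wʷ ++ C) < length (Y ++ (v ∷ W₂) ++ C)
            longer = begin-strict
              length (Wʷ ++ C)                        ≡⟨ cong (λ l → length (l ++ C)) eq ⟩
              length ((W₁ ++ v ∷ W₂) ++ C)            ≡⟨ cong length (++-assoc W₁ (v ∷ W₂) C) ⟩
              length (W₁ ++ (v ∷ W₂) ++ C)            ≡⟨ length-++ W₁ ⟩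
              length W₁ + length ((v ∷ W₂) ++ C)      <⟨ +-monoˡ-< (length ((v ∷ W₂) ++ C)) short ⟩
              length Y + length ((v ∷ W₂) ++ C)       ≡⟨ length-++ Y ⟨
              length (Y ++ (v ∷ W₂) ++ C)             ∎
              where open ≤-Reasoning
          ... | no ¬short = inj₁ (inj₁ (long⇒LongPath (Wʷ ++ C) (Linked-glue Wʷ entry (Cycle⇒Linked cyc)) uniq
                (subst (suc (2 * δ) ≤_) (sym (length-++ Wʷ)) (big+big δ<W big))))
            where
            inside : ∀ {x} → x ∈ N e → x ∈ (v ∷ W₂) ++ ys
            inside x∈ with N⊆WY x∈
            inside x∈ | inj₁ x∈W with ∈-++⁻ W₁ (subst (_ ∈_) eq x∈W)
            ... | inj₁ x∈W₁ = ⊥-elim (none₁ x∈W₁ x∈)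
            ... | inj₂ x∈W₂ = ∈-++⁺ˡ x∈W₂
            inside x∈ | inj₂ x∈Y with ∈-++⁻ ys x∈Y
            ... | inj₁ x∈ys = ∈-++⁺ʳ (v ∷ W₂) x∈ys
            ... | inj₂ (here refl) = ⊥-elim (∉N e x∈)
            δ<W : δ < length Wʷ
            δ<W = begin-strict
              δ                                ≤⟨ δ≤N e ⟩
              length (N e)                     ≤⟨ Unique-⊆⇒length≤ (N-unique e) inside ⟩
              length ((v ∷ W₂) ++ ys)          ≡⟨ length-++ (v ∷ W₂) ⟩
              length (v ∷ W₂) + length ys      <⟨ +-monoʳ-< (length (v ∷ W₂)) (subst (length ys <_) (sym (trans (length-++ ys) (+-comm _ 1))) ≤-refl) ⟩
              length (v ∷ W₂) + length Y       ≤⟨ +-monoʳ-≤ (length (v ∷ W₂)) (≮⇒≥ ¬short) ⟩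
              length (v ∷ W₂) + length W₁      ≡⟨ +-comm (length (v ∷ W₂)) (length W₁) ⟩
              length W₁ + length (v ∷ W₂)      ≡⟨ length-++ W₁ ⟨
              length (W₁ ++ v ∷ W₂)            ≡⟨ cong length eq ⟨
              length Wʷ                        ∎
              where open ≤-Reasoning

        module _ (N⊆P : ∀ {y} → y ∈ N w → y ∈ Wʷ ++ C) (zs : List V) (e : V) (C≡ : C ≡ zs ++ e ∷ []) where

          private
            chosen rejected : List V
            chosen   = selectPred (w ⇒_) e C
            rejected = rejectPred (w ⇒_) e C
            chosen-rejected : chosen ++ rejected ↭ C
            chosen-rejected = subst (λ D → selectPred (w ⇒_) e D ++ rejectPred (w ⇒_) e D ↭ D) (sym C≡)
              (cyclic-select-reject-↭ (w ⇒_) zs e)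

          -- The cyclic successor `y` of `x` is an out-neighbour of `w`; running around C from `y`
          -- ends at `x`.
          rotation-to : ∀ {x} → x ∈ chosen →
            ∃ λ y → ∃ λ R → ∃ λ ys → w ⟶ y × Cycle {R = _⟶_} y R × y ∷ R ↭ C × y ∷ R ≡ ys ++ x ∷ []
          rotation-to x∈ with ∈-selectPred⁻ (w ⇒_) e C x∈
          ... | as , y , bs , eq , wy , us , ending =
            y , bs ++ as , proj₁ (end as us eq ending) , wy , rotate-at as eq cyc
            , ↭-trans (++-comm (y ∷ bs) as) (↭-reflexive (sym eq)) , proj₂ (end as us eq ending)
            where
            end : ∀ {x y bs} as us → C ≡ as ++ y ∷ bs → e ∷ as ≡ us ++ x ∷ [] → ∃ λ ys → y ∷ bs ++ as ≡ ys ++ x ∷ []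
            -- If `y` is the first entry of C, its cyclic predecessor is the last entry `e`.
            end {y = y} {bs} [] [] eq refl = zs , trans (cong (y ∷_) (++-identityʳ bs)) (trans (sym eq) C≡)
            end [] (_ ∷ []) eq ()
            end [] (_ ∷ _ ∷ _) eq ()
            end (_ ∷ _) [] eq ()
            end {y = y} {bs} (a ∷ as) (_ ∷ us) eq ending =
              y ∷ bs ++ us , trans (cong (λ l → y ∷ bs ++ l) (proj₂ (∷-injective ending))) (cong (y ∷_) (sym (++-assoc bs us _)))

          -- After rotating C to end at `x`, a vertex `z` outside W lengthens the path. If `z` lies
          -- in W, the arc x → z closes a cycle through C and the part of W from `z` on, with the
          -- same vertices in total.
          improve : ∀ {x z} → x ∈ chosen → z ∈ N x → z ∉ C → Progress lasso
          improve {x} {z} x∈ z∈N z∉C with rotation-to x∈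
          ... | y , R , ys , wy , cycR , perm , eq = continue (z ∈? Wʷ)
            where
            chainP : Chain (Wʷ ++ y ∷ R)
            chainP = Linked-glue Wʷ (Linked-∷ʳ W₀ chainW wy) (Cycle⇒Linked cycR)
            permP : Wʷ ++ y ∷ R ↭ Wʷ ++ C
            permP = ++⁺ˡ Wʷ perm
            uniqP : Unique (Wʷ ++ y ∷ R)
            uniqP = Unique-resp-↭ (↭-sym permP) uniq
            x∈P : x ∈ Wʷ ++ y ∷ R
            x∈P = ∈-++⁺ʳ Wʷ (subst (x ∈_) (sym eq) (∈-++⁺ʳ ys (here refl)))
            snoc : ∀ as → Chain (as ++ y ∷ R) → Chain ((as ++ y ∷ R) ++ z ∷ [])
            snoc as ch = subst (λ l → Chain (l ++ z ∷ [])) (sym eq′) (Linked-∷ʳ (as ++ ys) (subst Chain eq′ ch) (N-sound z∈N))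
              where
              eq′ : as ++ y ∷ R ≡ (as ++ ys) ++ x ∷ []
              eq′ = trans (cong (as ++_) eq) (sym (++-assoc as ys (x ∷ [])))
            continue : Dec (z ∈ Wʷ) → Progress lasso
            continue (no z∉W) = inj₂ (inj₁
              ( (Wʷ ++ y ∷ R) ++ z ∷ [] , snoc Wʷ chainP , Unique-∷ʳ z∉ uniqP , sub′
              , subst₂ _<_ (↭-length permP) (sym (trans (length-++ (Wʷ ++ y ∷ R)) (+-comm _ 1))) ≤-refl))
              where
              z∉ : z ∉ Wʷ ++ y ∷ R
              z∉ z∈ with ∈-++⁻ Wʷ (∈-resp-↭ permP z∈)
              ... | inj₁ z∈W = z∉W z∈W
              ... | inj₂ z∈C = z∉C z∈C
              sub′ : ∀ {u} → u ∈ (Wʷ ++ y ∷ R) ++ z ∷ [] → u ∈ U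
              sub′ u∈ with ∈-++⁻ (Wʷ ++ y ∷ R) u∈
              ... | inj₁ u∈P = sub (∈-resp-↭ permP u∈P)
              ... | inj₂ (here refl) = closed (sub (∈-resp-↭ permP x∈P)) z∈N
            continue (yes z∈W) with ∈-∃++ z∈W
            ... | W₁ , W₂ , eqW = inj₂ (inj₂
              ( mkLasso W₁ z (W₂ ++ y ∷ R) (Linked-prefix W₁ chainQ)
                  (snoc (z ∷ W₂) (Linked-++⁻ʳ W₁ chainQ))
                  (subst Unique eqQ uniqP)
                  (λ u∈ → sub (∈-resp-↭ permP (subst (_ ∈_) (sym eqQ) u∈)))
                  (<-trans big longer)
              , trans (sym (↭-length permP)) (cong length eqQ)
              , longer))
              where
              eqQ : Wʷ ++ y ∷ R ≡ W₁ ++ z ∷ (W₂ ++ y ∷ R)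
              eqQ = trans (cong (_++ y ∷ R) eqW) (++-assoc W₁ (z ∷ W₂) (y ∷ R))
              chainQ : Chain (W₁ ++ z ∷ (W₂ ++ y ∷ R))
              chainQ = subst Chain eqQ chainP
              longer : length C < length (z ∷ (W₂ ++ y ∷ R))
              longer = s≤s (begin
                length C                   ≡⟨ ↭-length perm ⟨
                length (y ∷ R)             ≤⟨ m≤n+m _ (length W₂) ⟩
                length W₂ + length (y ∷ R) ≡⟨ length-++ W₂ ⟨
                length (W₂ ++ y ∷ R)       ∎)
                where open ≤-Reasoning

          -- A vertex of A with few out-neighbours in A has all others among the rejected vertices
          -- of C. The out-neighbours of `w` in C are as many as the vertices of A, and the others
          -- lie in `W₀`.
          conclude : ∀ a L → chosen ≡ a ∷ L → (∀ {x} → x ∈ chosen → ∀ {z} → z ∈ N x → z ∈ C) → LongPath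
          conclude a L chosen≡ N⊆C
            with subst (λ D → ∃ λ z → z ∈ D × q * length (filterᵇ (z ⇒_) D) ≤ p * length D) (sym chosen≡) (sparse a L)
          ... | x , x∈ , few = split (Wʷ ++ C) (Linked-glue Wʷ entry (Cycle⇒Linked cyc)) uniq length≡
            where
            α s d m : ℕ
            α = length chosen
            s = length rejected
            d = length (filterᵇ (x ⇒_) chosen)
            m = length W₀ + (α + s)
            length≡ : length (Wʷ ++ C) ≡ suc m
            length≡ = begin
              length (Wʷ ++ C)                  ≡⟨ trans (length-++ Wʷ) (cong (_+ length C) (trans (length-++ W₀) (+-comm _ 1))) ⟩
              suc (length W₀ + length C)        ≡⟨ cong (λ l → suc (length W₀ + l)) (↭-length chosen-rejected) ⟨
              suc (length W₀ + length (chosen ++ rejected)) ≡⟨ cong (λ l → suc (length W₀ + l)) (length-++ chosen) ⟩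
              suc m                             ∎
              where open ≡-Reasoning
            δ≤d+s : δ ≤ d + s
            δ≤d+s = begin
              δ                                             ≤⟨ δ≤N x ⟩
              length (N x)                                  ≤⟨ Unique-⊆⇒length≤ (N-unique x) inside ⟩
              length (filterᵇ (x ⇒_) chosen ++ rejected)    ≡⟨ length-++ (filterᵇ (x ⇒_) chosen) ⟩
              d + s                                         ∎
              where
              open ≤-Reasoning
              inside : ∀ {z} → z ∈ N x → z ∈ filterᵇ (x ⇒_) chosen ++ rejected
              inside z∈ with ∈-++⁻ chosen (∈-resp-↭ (↭-sym chosen-rejected) (N⊆C x∈ z∈))
              ... | inj₁ z∈A = ∈-++⁺ˡ (∈-filterᵇ⁺ (x ⇒_) chosen z∈A (N-sound z∈))
              ... | inj₂ z∈R = ∈-++⁺ʳ (filterᵇ (x ⇒_) chosen) z∈R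
            δ≤W₀+α : δ ≤ length W₀ + α
            δ≤W₀+α = begin
              δ                                    ≤⟨ δ≤N w ⟩
              length (N w)                         ≤⟨ Unique-⊆⇒length≤ (N-unique w) inside ⟩
              length (W₀ ++ filterᵇ (w ⇒_) C)      ≡⟨ length-++ W₀ ⟩
              length W₀ + length (filterᵇ (w ⇒_) C) ≡⟨ cong (length W₀ +_) (length-selectPred (w ⇒_) e C) ⟨
              length W₀ + α                        ∎
              where
              open ≤-Reasoning
              inside : ∀ {z} → z ∈ N w → z ∈ W₀ ++ filterᵇ (w ⇒_) C
              inside z∈ with ∈-++⁻ Wʷ (N⊆P z∈)
              ... | inj₂ z∈C = ∈-++⁺ʳ W₀ (∈-filterᵇ⁺ (w ⇒_) C z∈C (N-sound z∈))
              ... | inj₁ z∈W with ∈-++⁻ W₀ z∈W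
              ...   | inj₁ z∈W₀ = ∈-++⁺ˡ z∈W₀
              ...   | inj₂ (here refl) = ⊥-elim (∉N w z∈)
            split : ∀ xs → Chain xs → Unique xs → length xs ≡ suc m → LongPath
            split (v ∷ vs) chain uniq eq = v , vs , chain , uniq
              , subst (λ k → 2 * q * δ ≤ q * k + p * δ) (sym (suc-injective eq)) (lasso-arithmetic p q δ (length W₀) α s d p≤q few δ≤d+s δ≤W₀+α)

        stepTail : Progress lasso
        stepTail with search (λ y → ¬? (y ∈? (Wʷ ++ C))) (N w)
        ... | inj₁ (y , y∈N , y∉) = branch (length U) [] y (Linked-∷ʳ W₀ chainW (N-sound y∈N)) (Unique-∷ʳ y∉ uniq)
                (λ { (here refl) → closed (sub (∈-++⁺ˡ (∈-++⁺ʳ W₀ (here refl)))) y∈N })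
                (m<n+m (length U) (subst (0 <_) (sym (trans (length-++ (Wʷ ++ C)) (+-comm _ 1))) (s≤s z≤n)))
        ... | inj₂ none = withLast (initLast C) refl
          where
          N⊆P : ∀ {y} → y ∈ N w → y ∈ Wʷ ++ C
          N⊆P {y} y∈ with y ∈? (Wʷ ++ C)
          ... | yes y∈P = y∈P
          ... | no  y∉P = ⊥-elim (none y∈ y∉P)
          withLast : ∀ {D} → List.InitLast D → C ≡ D → Progress lasso
          withLast [] ()
          withLast (zs ∷ʳ′ e) C≡ with search (λ x → escapes x) (selectPred (w ⇒_) e C)
            where
            escapes : ∀ x → Dec (∃ λ z → z ∈ N x × z ∉ C)
            escapes x with search (λ z → ¬? (z ∈? C)) (N x)
            ... | inj₁ found = yes found
            ... | inj₂ none  = no λ (_ , z∈ , z∉) → none z∈ z∉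
          ... | inj₁ (x , x∈ , z , z∈ , z∉) = improve N⊆P zs e C≡ x∈ z∈ z∉
          ... | inj₂ none′ = inj₁ (inj₁ (conclude N⊆P zs e C≡ e _ chosen≡ inside))
            where
            inside : ∀ {x} → x ∈ selectPred (w ⇒_) e C → ∀ {z} → z ∈ N x → z ∈ C
            inside x∈ {z} z∈ with z ∈? C
            ... | yes z∈C = z∈C
            ... | no  z∉C = ⊥-elim (none′ x∈ (z , z∈ , z∉C))
            -- The arc from `w` to `c` makes `e`, the cyclic predecessor of `c`, a member of A;
            -- hence A is nonempty.
            wc : w ⟶ c
            wc = Linked.head (Linked-++⁻ʳ W₀ (subst Chain (++-assoc W₀ (w ∷ []) (c ∷ [])) entry))
            chosen≡ : selectPred (w ⇒_) e C ≡ e ∷ selectPred (w ⇒_) c cs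
            chosen≡ rewrite wc = refl

      -- Iterating the improvements

      step : ∀ (l : Lasso) → Progress l
      step l@(mkLasso W c cs entry cyc uniq sub big) with initLast W
      ... | []        = stepCycle l refl
      ... | W₀ ∷ʳ′ w  = stepTail W₀ w c cs entry cyc uniq sub big

      -- Two nested bounds: `f₁` limits how often the number of vertices can grow, since it is at
      -- most |U|; `f₂` in `loop` limits the growth of the cycle while that number is fixed.
      solve : ∀ f₁ (l : Lasso) → length U < total l + f₁ → LongPath ⊎ ClosedSubset
      solve zero l fuel =
        ⊥-elim (<⇒≱ fuel (subst (_≤ length U) (sym (+-identityʳ _)) (Unique-⊆⇒length≤ (uniq l) (sub l))))
      solve (suc f₁) l fuel = loop (suc (total l)) l fuel (m≤n+m (suc (total l)) (length (c l ∷ cs l)))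
        where
        loop : ∀ f₂ (l : Lasso) → length U < total l + suc f₁ → total l < length (c l ∷ cs l) + f₂ →
          LongPath ⊎ ClosedSubset
        loop zero l _ fuel₂ =
          ⊥-elim (<⇒≱ fuel₂ (subst₂ _≤_ (sym (+-identityʳ _)) (sym (length-++ (W l))) (m≤n+m _ (length (W l)))))
        loop (suc f₂) l fuel₁ fuel₂ with step l
        ... | inj₁ done = done
        ... | inj₂ (inj₁ path@(zs , _)) =
          let l′ , longer = close (suc (length U)) (total l) path (m≤n+m (suc (length U)) (length zs))
          in solve f₁ l′ (<-≤-trans fuel₁ (subst (_≤ total l′ + f₁) (sym (+-suc (total l) f₁)) (+-monoˡ-≤ f₁ longer)))
        ... | inj₂ (inj₂ (l′ , total≡ , longer)) = loop f₂ l′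
          (subst (λ t → length U < t + suc f₁) total≡ fuel₁)
          (subst (_< length (c l′ ∷ cs l′) + f₂) total≡
            (<-≤-trans fuel₂ (subst (_≤ length (c l′ ∷ cs l′) + f₂) (sym (+-suc _ f₂)) (+-monoˡ-≤ f₂ longer))))

    -- Each closed subset is strictly smaller and nonempty, so passing to one can be repeated at
    -- most `n` times.
    longPath : ∀ n U → (∀ {x y} → x ∈ U → y ∈ N x → y ∈ U) → length U ≤ n → ∃ (_∈ U) → LongPath
    longPath n U closed len (v , v∈) = continue n len
      (solve U closed (suc (length U)) l (m≤n+m (suc (length U)) (total l)))
      where
      open Lasso using (total)
      start : PathIn U closed 0
      start = v ∷ [] , [-] , [] ∷ [] , (λ { (here refl) → v∈ }) , s≤s z≤n
      l : Lasso U closed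
      l = proj₁ (close U closed (suc (length U)) 0 start (m≤n+m (suc (length U)) 1))
      continue : ∀ n → length U ≤ n → LongPath ⊎ ClosedSubset U closed → LongPath
      continue n       len (inj₁ found) = found
      continue zero    len (inj₂ (U′ , _ , shorter , _)) with () ← <-≤-trans shorter len
      continue (suc n) len (inj₂ (U′ , closed′ , shorter , nonempty)) =
        longPath n U′ closed′ (s≤s⁻¹ (≤-trans shorter len)) nonempty

open import Data.Nat using (ℕ; zero; suc; _+_; _≤_; _<_; _*_; z≤n; s≤s)
open import Data.Nat.Properties
open import Data.Fin.Subset using (∣_∣)
open Density using (∈-filterᵇ⁻; ∃-lowOutDegree; module OutDegree)
open Paths using (module LongPath)

-- The theorem for digraphs

length-filterᵇ-tabulate : ∀ {m} (f : A → Bool) (g : Fin m → A) →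
  ∣ Vec.tabulate (f ∘ g) ∣ ≡ length (filterᵇ f (List.tabulate g))
length-filterᵇ-tabulate {m = zero}  f g = refl
length-filterᵇ-tabulate {m = suc m} f g with f (g Fin.zero)
... | true  = cong suc (length-filterᵇ-tabulate f (g ∘ Fin.suc))
... | false = length-filterᵇ-tabulate f (g ∘ Fin.suc)

lookup-injective : ∀ {xs : List A} → Unique xs → ∀ {i j} → lookup xs i ≡ lookup xs j → i ≡ j
lookup-injective (x∉ ∷ u) {Fin.zero}  {Fin.zero}  eq = refl
lookup-injective {xs = x ∷ xs} (x∉ ∷ u) {Fin.zero}  {Fin.suc j} eq = ⊥-elim (All.lookup x∉ (∈-lookup {xs = xs} j) eq)
lookup-injective {xs = x ∷ xs} (x∉ ∷ u) {Fin.suc i} {Fin.zero}  eq = ⊥-elim (All.lookup x∉ (∈-lookup {xs = xs} i) (sym eq))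
lookup-injective (x∉ ∷ u) {Fin.suc i} {Fin.suc j} eq = cong Fin.suc (lookup-injective u eq)

Linked-lookup : ∀ {R : A → A → Set} x xs → Linked R (x ∷ xs) →
  ∀ (i : Fin (length xs)) → R (lookup (x ∷ xs) (inject₁ i)) (lookup (x ∷ xs) (Fin.suc i))
Linked-lookup x (y ∷ ys) (r ∷ l) Fin.zero    = r
Linked-lookup x (y ∷ ys) (r ∷ l) (Fin.suc i) = Linked-lookup y ys l i

-- Here a / q = 2 - p / q, and `r` expands this fraction to the one in the theorem.
cancel-scale : ∀ r a p q {a′ q′} δ k → a + p ≡ 2 * q → a′ ≡ r * a → q′ ≡ r * q →
  2 * q * δ ≤ q * k + p * δ → a′ * δ ≤ q′ * k
cancel-scale r a p q δ k 2q≡ refl refl le = begin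
  r * a * δ    ≡⟨ *-assoc r a δ ⟩
  r * (a * δ)  ≤⟨ *-monoʳ-≤ r (+-cancelʳ-≤ (p * δ) (a * δ) (q * k)
                    (subst (_≤ q * k + p * δ) (trans (cong (_* δ) (sym 2q≡)) (*-distribʳ-+ δ a p)) le)) ⟩
  r * (q * k)  ≡⟨ *-assoc r q k ⟨
  r * q * k    ∎
  where open ≤-Reasoning

module _ (D : Digraph) where

  arc≢ : ∀ {u v} → arc D u v ≡ true → u ≢ v
  arc≢ {u} uv refl with () ← trans (sym uv) (loopless D u)

  girth⇒no-digon : Girth≥ D 4 → ∀ {u v} → arc D u v ≡ true → arc D v u ≡ true → ⊥
  girth⇒no-digon girth {u} {v} uv vu with girth 1 cycle
    where
    cycle : DirectedCycle D 1
    cycle = record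
      { vertex   = λ { Fin.zero → u ; (Fin.suc Fin.zero) → v }
      ; distinct = λ { {Fin.zero} {Fin.zero} _ → refl
                     ; {Fin.zero} {Fin.suc Fin.zero} eq → ⊥-elim (arc≢ uv eq)
                     ; {Fin.suc Fin.zero} {Fin.zero} eq → ⊥-elim (arc≢ vu eq)
                     ; {Fin.suc Fin.zero} {Fin.suc Fin.zero} _ → refl }
      ; arcs     = λ { Fin.zero → uv }
      ; closing  = vu }
  ... | s≤s (s≤s ())

  girth⇒no-triangle : Girth≥ D 4 → ∀ {u v w} → arc D u v ≡ true → arc D v w ≡ true → arc D w u ≡ true → ⊥
  girth⇒no-triangle girth {u} {v} {w} uv vw wu with girth 2 cycle
    where
    cycle : DirectedCycle D 2
    cycle = record
      { vertex   = lookup (u ∷ v ∷ w ∷ [])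
      ; distinct = lookup-injective ((arc≢ uv ∷ (arc≢ wu ∘ sym) ∷ []) ∷ (arc≢ vw ∷ []) ∷ [] ∷ [])
      ; arcs     = λ { Fin.zero → uv ; (Fin.suc Fin.zero) → vw }
      ; closing  = wu }
  ... | s≤s (s≤s (s≤s ()))

  module _ (nonempty : NonEmpty D) {δ : ℕ} (δ>0 : 0 < δ) (δ≤ : MinOutDeg≥ D δ) (p q : ℕ) (p≤q : p ≤ q)
    (no-digon : ∀ {u v} → arc D u v ≡ true → arc D v u ≡ true → ⊥)
    (sparse : ∀ x L → ∃ λ z → z ∈ x ∷ L × q * length (filterᵇ (arc D z) (x ∷ L)) ≤ p * length (x ∷ L)) where

    private
      V : Set
      V = Fin (n D)
      out : V → List V
      out v = filterᵇ (arc D v) (allFin (n D))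

    directedPath : Σ ℕ λ k → DirectedPath D k × 2 * q * δ ≤ q * k + p * δ
    directedPath = toDirectedPath (longPath (n D) (allFin (n D)) (λ {_} {y} _ _ → ∈-allFin y)
                     (≤-reflexive (length-tabulate id)) (Fin.fromℕ< nonempty , ∈-allFin _))
      where
      open LongPath Fin._≟_ (arc D) (loopless D) out (λ v → Unique.filter⁺ (T? ∘ arc D v) (Unique.allFin⁺ (n D)))
        (λ {v} u∈ → proj₂ (∈-filterᵇ⁻ (arc D v) (allFin (n D)) u∈))
        δ δ>0 (λ v → subst (δ ≤_) (length-filterᵇ-tabulate (arc D v) id) (δ≤ v)) p q p≤q sparse
        (OutDegree.∃-half (arc D) no-digon)
      toDirectedPath : LongPath → Σ ℕ λ k → DirectedPath D k × 2 * q * δ ≤ q * k + p * δ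
      toDirectedPath (v , vs , chain , uniq , bound) = length vs , record
        { vertex   = lookup (v ∷ vs)
        ; distinct = lookup-injective uniq
        ; arcs     = Linked-lookup v vs chain } , bound

theorem2 : (δ : ℕ) → 0 < δ →
    ((D : Digraph) → NonEmpty D → Oriented D → MinOutDeg≥ D δ →
    Σ ℕ (λ k → DirectedPath D k × 3 * δ ≤ 2 * k))
    ×
    ((D : Digraph) → NonEmpty D → Girth≥ D 4 → MinOutDeg≥ D δ →
    Σ ℕ (λ k → DirectedPath D k × 16535 * δ ≤ 10000 * k))
theorem2 δ δ>0 = oriented , girth4
  where
  oriented : (D : Digraph) → NonEmpty D → Oriented D → MinOutDeg≥ D δ →
    Σ ℕ (λ k → DirectedPath D k × 3 * δ ≤ 2 * k)
  oriented D nonempty antisym δ≤ =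
    let k , path , le = directedPath D nonempty δ>0 δ≤ 1 2 (s≤s z≤n) no-digon half
    in k , path , cancel-scale 1 3 1 2 δ k refl refl refl le
    where
    no-digon : ∀ {u v} → arc D u v ≡ true → arc D v u ≡ true → ⊥
    no-digon {u} {v} uv vu with () ← trans (sym vu) (antisym u v uv)
    half : ∀ x L → ∃ λ z → z ∈ x ∷ L × 2 * length (filterᵇ (arc D z) (x ∷ L)) ≤ 1 * length (x ∷ L)
    half x L = let z , z∈ , lt = OutDegree.∃-half (arc D) no-digon x L
               in z , z∈ , subst (2 * length (filterᵇ (arc D z) (x ∷ L)) ≤_) (sym (*-identityˡ _)) (<⇒≤ lt)
  girth4 : (D : Digraph) → NonEmpty D → Girth≥ D 4 → MinOutDeg≥ D δ →
    Σ ℕ (λ k → DirectedPath D k × 16535 * δ ≤ 10000 * k)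
  girth4 D nonempty girth δ≤ =
    let k , path , le = directedPath D nonempty δ>0 δ≤ 693 2000 (m≤m+n 693 1307) (girth⇒no-digon D girth)
                          (∃-lowOutDegree (arc D) (girth⇒no-digon D girth) (girth⇒no-triangle D girth))
    -- 2 · 2000 - 693 = 3307, and 3307 / 2000 = 16535 / 10000.
    in k , path , cancel-scale 5 3307 693 2000 δ k refl refl refl le
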